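{- Let $B(z,u,v)=\sum_D z^{|D|-1}u^{\mathrm{top}(D)}v^{\mathrm{cr}(D)}$, the sum running over all rooted indecomposable chord diagrams $D$, and let $C(z,u,v)$ be the same sum restricted to connected chord diagrams. Then $$B(z,u,v)=u+z\,B(z,1+uv,v)\,B(z,u,v),$$ $$C(z,u,v)=u+z\big(C(z,1+uv,v)-C(z,1,v)\big)\,C(z,u,v).$$
   Context: A rooted chord diagram of size $|D|=n$ is a perfect matching of $\{0<\dots<2n-1\}$ into $n$ chords $(a,b)$, $a<b$, up to isomorphism. Chords $(a,b),(c,d)$ cross if $a<c<b<d$ or $c<a<d<b$; $\mathrm{cr}(D)$ is the number of unordered crossing pairs. A chord $(a,b)$ is below $(c,d)$ if $c<a<b<d$; a top chord is a chord not below any other chord, and $\mathrm{top}(D)$ is their number. A diagram is connected if its crossing graph on chords is connected, and indecomposable if it is not the side-by-side concatenation of two nonempty diagrams. -}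

module Defs where

open import Data.Bool using (if_then_else_)
open import Data.Fin as Fin using (Fin; _↑ˡ_; _↑ʳ_)
import Data.Fin.Properties as Fin
open import Data.Integer as ℤ using (ℤ; 0ℤ; 1ℤ)
open import Data.List using (List; []; _∷_; [_]; _++_; map; foldr; filter; length; cartesianProduct; cartesianProductWith; allFin; upTo)
open import Data.List.Membership.Propositional using (_∈_; lose)
open import Data.List.Membership.Propositional.Properties using (∈-allFin; ∈-cartesianProduct⁺; ∈-cartesianProductWith⁺)
open import Data.List.Relation.Unary.All using (All; all?)
open import Data.List.Relation.Unary.Any using (here; there; any?; satisfied)
open import Data.Nat as ℕ using (ℕ; zero; suc; _∸_)
import Data.Nat.Properties as ℕ
open import Data.Product using (∃; ∃₂; _×_; _,_)
import Data.Product.Properties as Product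
open import Data.Sum using (_⊎_; inj₁; inj₂)
open import Data.Vec as Vec using (Vec; lookup)
import Data.Vec.Properties as Vec
open import Relation.Binary using (Decidable; DecidableEquality)
open import Relation.Binary.Construct.Closure.ReflexiveTransitive using (Star; ε; _◅_; _◅◅_)
open import Relation.Binary.PropositionalEquality using (_≡_; _≢_; refl)
open import Relation.Nullary using (¬_; Dec)
open import Relation.Nullary.Decidable using (map′; ¬?; ⌊_⌋; _×-dec_; _⊎-dec_; _→-dec_)
import Relation.Unary as U

-- A perfect matching of {0 < … < m-1} is given by the table sending each
-- point to the other endpoint of its chord, so by a fixed-point-free
-- involution.  A vector (not a function) is used so that _≡_ is equality of
-- diagrams.

Table : ℕ → Set
Table m = Vec (Fin m) m

IsMatching : ∀ {m} → Table m → Set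
IsMatching D = ∀ a → lookup D (lookup D a) ≡ a × lookup D a ≢ a

isMatching? : ∀ {m} → U.Decidable (IsMatching {m})
isMatching? D = Fin.all? λ a →
  (lookup D (lookup D a) Fin.≟ a) ×-dec ¬? (lookup D a Fin.≟ a)

vectors : ∀ {A : Set} → List A → ∀ n → List (Vec A n)
vectors xs zero    = [ Vec.[] ]
vectors xs (suc n) = cartesianProductWith Vec._∷_ xs (vectors xs n)

∈-vectors : ∀ {A : Set} {xs : List A} → (∀ x → x ∈ xs) →
            ∀ {n} (v : Vec A n) → v ∈ vectors xs n
∈-vectors all Vec.[]      = here refl
∈-vectors all (x Vec.∷ v) = ∈-cartesianProductWith⁺ Vec._∷_ (all x) (∈-vectors all v)

tables : ∀ m → List (Table m)
tables m = vectors (allFin m) m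

∈-tables : ∀ {m} (D : Table m) → D ∈ tables m
∈-tables = ∈-vectors ∈-allFin

-- The chord diagrams of size n, each listed once.

diagrams : ∀ n → List (Table (2 ℕ.* n))
diagrams n = filter isMatching? (tables (2 ℕ.* n))

Chord : ℕ → Set
Chord m = Fin m × Fin m

IsChord : ∀ {m} → Table m → Chord m → Set
IsChord D (a , b) = a Fin.< b × lookup D a ≡ b

isChord? : ∀ {m} (D : Table m) → U.Decidable (IsChord D)
isChord? D (a , b) = (a Fin.<? b) ×-dec (lookup D a Fin.≟ b)

allPairs : ∀ m → List (Chord m)
allPairs m = cartesianProduct (allFin m) (allFin m)

∈-allPairs : ∀ {m} (c : Chord m) → c ∈ allPairs m
∈-allPairs (a , b) = ∈-cartesianProduct⁺ (∈-allFin a) (∈-allFin b)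

chords : ∀ {m} → Table m → List (Chord m)
chords {m} D = filter (isChord? D) (allPairs m)

Crosses : ∀ {m} → Chord m → Chord m → Set
Crosses (a , b) (c , d) = (a Fin.< c × c Fin.< b × b Fin.< d)
                        ⊎ (c Fin.< a × a Fin.< d × d Fin.< b)

crosses? : ∀ {m} → Decidable (Crosses {m})
crosses? (a , b) (c , d) =
  ((a Fin.<? c) ×-dec (c Fin.<? b) ×-dec (b Fin.<? d)) ⊎-dec
  ((c Fin.<? a) ×-dec (a Fin.<? d) ×-dec (d Fin.<? b))

unorderedPairs : ∀ {A : Set} → List A → List (A × A)
unorderedPairs []       = []
unorderedPairs (x ∷ xs) = map (x ,_) xs ++ unorderedPairs xs

cr : ∀ {m} → Table m → ℕ
cr D = length (filter (λ (c , d) → crosses? c d) (unorderedPairs (chords D)))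

Below : ∀ {m} → Chord m → Chord m → Set
Below (a , b) (c , d) = c Fin.< a × a Fin.< b × b Fin.< d

below? : ∀ {m} → Decidable (Below {m})
below? (a , b) (c , d) = (c Fin.<? a) ×-dec (a Fin.<? b) ×-dec (b Fin.<? d)

IsTop : ∀ {m} → Table m → Chord m → Set
IsTop D c = All (λ d → ¬ Below c d) (chords D)

isTop? : ∀ {m} (D : Table m) → U.Decidable (IsTop D)
isTop? D c = all? (λ d → ¬? (below? c d)) (chords D)

top : ∀ {m} → Table m → ℕ
top D = length (filter (isTop? D) (chords D))

_⊕_ : ∀ {p q} → Table p → Table q → Table (p ℕ.+ q)
_⊕_ {p} {q} D₁ D₂ = Vec.map (_↑ˡ q) D₁ Vec.++ Vec.map (p ↑ʳ_) D₂

-- p and q count points; they are necessarily even, since D₁ and D₂ are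
-- perfect matchings.

data Decomposable : ∀ {m} → Table m → Set where
  concatenation : ∀ {p q} (D₁ : Table p) (D₂ : Table q) →
                  IsMatching D₁ → IsMatching D₂ → 0 ℕ.< p → 0 ℕ.< q →
                  Decomposable (D₁ ⊕ D₂)

-- The empty diagram satisfies this, but the series below start at size 1.

Indecomposable : ∀ {m} → Table m → Set
Indecomposable D = ¬ Decomposable D

private
  searchTables : ∀ {m} {P : Table m → Set} → U.Decidable P → Dec (∃ P)
  searchTables {m} P? =
    map′ satisfied (λ (D , pD) → lose (∈-tables D) pD) (any? P? (tables m))

  Summands : ∀ {m} → Table m → ∀ p q → Table p → Table q → Set
  Summands {m} D p q D₁ D₂ =
    IsMatching D₁ × IsMatching D₂ × 0 ℕ.< p × 0 ℕ.< q ×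
    _≡_ {A = ∃ Table} (p ℕ.+ q , D₁ ⊕ D₂) (m , D)

  summands? : ∀ {m} (D : Table m) p q D₁ D₂ → Dec (Summands D p q D₁ D₂)
  summands? D p q D₁ D₂ =
    isMatching? D₁ ×-dec isMatching? D₂ ×-dec (0 ℕ.<? p) ×-dec (0 ℕ.<? q) ×-dec
    Product.≡-dec ℕ._≟_ (Vec.≡-dec Fin._≟_) _ _

decomposable? : ∀ {m} → U.Decidable (Decomposable {m})
decomposable? {m} D = map′ to from
  (ℕ.anyUpTo? (λ p → ℕ.anyUpTo? (λ q →
     searchTables λ D₁ → searchTables λ D₂ → summands? D p q D₁ D₂)
     (suc m)) (suc m))
  where
  Search : ∀ {m} → Table m → Set
  Search {m} D = ∃ λ p → p ℕ.< suc m × ∃ λ q → q ℕ.< suc m ×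
                 ∃₂ λ D₁ D₂ → Summands D p q D₁ D₂

  to : Search D → Decomposable D
  to (p , _ , q , _ , D₁ , D₂ , m₁ , m₂ , 0<p , 0<q , refl) =
    concatenation D₁ D₂ m₁ m₂ 0<p 0<q

  from : ∀ {m} {D : Table m} → Decomposable D → Search D
  from (concatenation {p} {q} D₁ D₂ m₁ m₂ 0<p 0<q) =
    p , ℕ.s≤s (ℕ.m≤m+n p q) , q , ℕ.s≤s (ℕ.m≤n+m q p) ,
    D₁ , D₂ , m₁ , m₂ , 0<p , 0<q , refl

indecomposable? : ∀ {m} → U.Decidable (Indecomposable {m})
indecomposable? D = ¬? (decomposable? D)

-- Edges of the crossing graph, whose vertices are the chords of D.

Edge : ∀ {m} → Table m → Chord m → Chord m → Set
Edge D c d = IsChord D c × IsChord D d × Crosses c d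

edge? : ∀ {m} (D : Table m) → Decidable (Edge D)
edge? D c d = isChord? D c ×-dec isChord? D d ×-dec crosses? c d

-- As for Indecomposable, the empty diagram never enters the series.

Connected : ∀ {m} → Table m → Set
Connected D = ∀ c d → IsChord D c → IsChord D d → Star (Edge D) c d

-- Reachability in a finite decidable graph is decidable: Via vs x y holds if
-- there is a path from x to y with all interior vertices in vs.

module Reachability {A : Set} {R : A → A → Set} (_≟_ : DecidableEquality A)
                    (R? : Decidable R) where

  Via : List A → A → A → Set
  Via []       x y = x ≡ y ⊎ R x y
  Via (w ∷ vs) x y = Via vs x y ⊎ (Via vs x w × Via vs w y)

  via? : ∀ vs → Decidable (Via vs)
  via? []       x y = (x ≟ y) ⊎-dec R? x y
  via? (w ∷ vs) x y = via? vs x y ⊎-dec (via? vs x w ×-dec via? vs w y)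

  via⇒star : ∀ vs {x y} → Via vs x y → Star R x y
  via⇒star []       (inj₁ refl)    = ε
  via⇒star []       (inj₂ r)       = r ◅ ε
  via⇒star (w ∷ vs) (inj₁ p)       = via⇒star vs p
  via⇒star (w ∷ vs) (inj₂ (p , q)) = via⇒star vs p ◅◅ via⇒star vs q

  via-base : ∀ vs {x y} → x ≡ y ⊎ R x y → Via vs x y
  via-base []       p = p
  via-base (w ∷ vs) p = inj₁ (via-base vs p)

  via-join : ∀ {vs v x y} → v ∈ vs → Via vs x v → Via vs v y → Via vs x y
  via-join {w ∷ vs} (here refl) p q = inj₂ (into p , outof q)
    where
    into : ∀ {x} → Via (w ∷ vs) x w → Via vs x w
    into (inj₁ p)       = p
    into (inj₂ (p , _)) = p
    outof : ∀ {y} → Via (w ∷ vs) w y → Via vs w y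
    outof (inj₁ p)       = p
    outof (inj₂ (_ , p)) = p
  via-join (there i) (inj₁ p)       (inj₁ q)       = inj₁ (via-join i p q)
  via-join (there i) (inj₁ p)       (inj₂ (q , r)) = inj₂ (via-join i p q , r)
  via-join (there i) (inj₂ (p , q)) (inj₁ r)       = inj₂ (p , via-join i q r)
  via-join (there i) (inj₂ (p , _)) (inj₂ (_ , r)) = inj₂ (p , r)

  star⇒via : ∀ {vs} → (∀ v → v ∈ vs) → ∀ {x y} → Star R x y → Via vs x y
  star⇒via {vs} all ε        = via-base vs (inj₁ refl)
  star⇒via {vs} all (r ◅ rs) = via-join (all _) (via-base vs (inj₂ r)) (star⇒via all rs)

  star? : ∀ {vs} → (∀ v → v ∈ vs) → Decidable (Star R)
  star? {vs} all x y = map′ (via⇒star vs) (star⇒via all) (via? vs x y)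

connected? : ∀ {m} → U.Decidable (Connected {m})
connected? {m} D =
  map′ (λ f (a , b) (c , d) → f a b c d) (λ f a b c d → f (a , b) (c , d))
    (Fin.all? λ a → Fin.all? λ b → Fin.all? λ c → Fin.all? λ d →
     isChord? D (a , b) →-dec isChord? D (c , d) →-dec
     star? ∈-allPairs (a , b) (c , d))
  where open Reachability (Product.≡-dec Fin._≟_ Fin._≟_) (edge? D)

-- A polynomial is a formal sum of terms k·uⁱ·vʲ, in which terms may repeat;
-- polynomials are compared by _≈ᴾ_, that is, coefficient by coefficient.

record Term : Set where
  constructor _u^_v^_
  field
    coefficient : ℤ
    degreeU     : ℕ
    degreeV     : ℕ

Poly : Set
Poly = List Term

coeff : Poly → ℕ → ℕ → ℤ
coeff []                    i j = 0ℤ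
coeff ((k u^ i′ v^ j′) ∷ p) i j =
  (if ⌊ (i′ ℕ.≟ i) ×-dec (j′ ℕ.≟ j) ⌋ then k else 0ℤ) ℤ.+ coeff p i j

infix 4 _≈ᴾ_
_≈ᴾ_ : Poly → Poly → Set
p ≈ᴾ q = ∀ i j → coeff p i j ≡ coeff q i j

0ᴾ 1ᴾ uᴾ vᴾ : Poly
0ᴾ = []
1ᴾ = [ 1ℤ u^ 0 v^ 0 ]
uᴾ = [ 1ℤ u^ 1 v^ 0 ]
vᴾ = [ 1ℤ u^ 0 v^ 1 ]

infixl 6 _+ᴾ_
infixl 7 _*ᴾ_
infixr 8 _^ᴾ_
infix  8 -ᴾ_

_+ᴾ_ : Poly → Poly → Poly
_+ᴾ_ = _++_

-ᴾ_ : Poly → Poly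
-ᴾ_ = map λ (k u^ i v^ j) → (ℤ.- k) u^ i v^ j

_*ᴾ_ : Poly → Poly → Poly
_*ᴾ_ = cartesianProductWith λ (k u^ i v^ j) (k′ u^ i′ v^ j′) →
  (k ℤ.* k′) u^ (i ℕ.+ i′) v^ (j ℕ.+ j′)

_^ᴾ_ : Poly → ℕ → Poly
p ^ᴾ zero  = 1ᴾ
p ^ᴾ suc n = p *ᴾ p ^ᴾ n

sumᴾ : List Poly → Poly
sumᴾ = foldr _+ᴾ_ 0ᴾ

substU : Poly → Poly → Poly
substU q p = sumᴾ (map (λ (k u^ i v^ j) → [ k u^ 0 v^ j ] *ᴾ q ^ᴾ i) p)

Series : Set
Series = ℕ → Poly

infix 4 _≋_
_≋_ : Series → Series → Set
f ≋ g = ∀ n → f n ≈ᴾ g n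

infixl 6 _+_ _-_
infixl 7 _*_
infixl 9 _[u≔_]

const : Poly → Series
const p zero    = p
const p (suc _) = 0ᴾ

z : Series
z 1 = 1ᴾ
z _ = 0ᴾ

_+_ _-_ _*_ : Series → Series → Series
(f + g) n = f n +ᴾ g n
(f - g) n = f n +ᴾ -ᴾ g n
(f * g) n = sumᴾ (map (λ i → f i *ᴾ g (n ∸ i)) (upTo (suc n)))

_[u≔_] : Series → Poly → Series
(f [u≔ q ]) n = substU q (f n)

-- Since D is weighted by z^{|D|-1}, the coefficient of zⁿ collects the
-- diagrams of size n + 1.

weight : ∀ {m} → Table m → Poly
weight D = [ 1ℤ u^ top D v^ cr D ]

B C : Series
B n = sumᴾ (map weight (filter indecomposable? (diagrams (suc n))))
C n = sumᴾ (map weight (filter connected? (diagrams (suc n))))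

{-# OPTIONS --safe #-}

-- Read a diagram from left to right.  When a point closes one of the h + 1
-- open chords, numbered 0, …, h by age, say chord i, that chord crosses exactly
-- the h - i chords opened after it and still open, and it is a top chord iff
-- i = 0.  So the diagrams are weighted lattice paths in which a closing step
-- from height h + 1 has weight vʰ⁻ⁱ, times u if i = 0.  A path of an
-- indecomposable diagram is cut at its returns to height 1.  Between two
-- returns, either the bottom chord is closed (weight u vʰ⁺¹ from height h + 2),
-- the next oldest chord then taking its place, or some other chord is closed.
-- Forgetting the bottom chord leaves a path of height one less in which closing
-- the oldest chord has weight (1 + uv) vʰ, and this is the equation for B.
--
-- A diagram is connected iff no proper interval of points is a union of chords.
-- Along a path one records at which points such an interval can still start.
-- With the bottom chord forgotten, these starts evolve in the same way, except
-- that a diagram whose oldest chord never takes the place of the bottom one is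
-- itself a forbidden interval: hence the correction C(z,1,v).

module Submission where

open import Defs hiding (_+_; _-_; _*_)
open import Algebra.Bundles using (CommutativeSemiring)
open import Algebra.Structures using (IsCommutativeSemiring)
import Algebra.Structures.Biased as Biased
open import Data.Bool using (Bool; true; false; _∧_; if_then_else_)
import Data.Bool.Properties as Bool
open import Data.Fin as Fin using (Fin; zero; suc; toℕ; fromℕ<; punchIn; punchOut; _↑ˡ_; _↑ʳ_; splitAt)
import Data.Fin.Properties as Fin
open import Data.Integer as ℤ using (ℤ; 0ℤ; 1ℤ)
import Data.Integer.Properties as ℤ
open import Data.List as List using (List; []; _∷_; [_]; _++_; map; filter; length; concat; applyUpTo)
import Data.List.Properties as List
open import Data.List.Membership.Propositional using (_∈_)
open import Data.List.Membership.Propositional.Properties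
  using (∈-filter⁺; ∈-filter⁻; ∈-map⁺; ∈-map⁻; ∈-tabulate⁺; ∈-tabulate⁻; ∈-++⁺ˡ; ∈-++⁺ʳ; ∈-++⁻; ∈-concat⁺′; ∈-concat⁻′)
open import Data.List.Membership.Propositional.Properties.WithK using (unique∧set⇒bag)
open import Data.List.Relation.Binary.BagAndSetEquality using (∼bag⇒↭)
open import Data.List.Relation.Binary.Disjoint.Propositional using (Disjoint)
open import Data.List.Relation.Binary.Permutation.Propositional as ↭ using (_↭_; prep; swap)
open import Data.List.Relation.Binary.Permutation.Propositional.Properties using (↭-length; filter-↭; ∈-resp-↭)
import Data.List.Relation.Unary.All as All
import Data.List.Relation.Unary.All.Properties as All
import Data.List.Relation.Unary.AllPairs as AllPairs
import Data.List.Relation.Unary.AllPairs.Properties as AllPairs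
open import Data.List.Relation.Unary.Any using (here; there)
open import Data.List.Relation.Unary.Unique.Propositional using (Unique)
import Data.List.Relation.Unary.Unique.Propositional.Properties as Unique
open import Data.Nat as ℕ using (ℕ; zero; suc; _∸_; _<ᵇ_; _≡ᵇ_; _≤_; _<_; z≤n; s≤s; s≤s⁻¹)
import Data.Nat.Properties as ℕ
open import Data.Product using (∃; _×_; _,_; proj₁; proj₂)
import Data.Product.Properties as Product
open import Data.Sum using (_⊎_; inj₁; inj₂)
open import Data.Vec as Vec using (Vec; lookup; tabulate; insertAt)
import Data.Vec.Properties as Vec
open import Function using (_∘_; _⇔_; mk⇔; Equivalence)
open import Level using (0ℓ)
open import Relation.Binary using (Decidable; IsEquivalence; Symmetric; tri<; tri≈; tri>)
open import Relation.Binary.Construct.Closure.ReflexiveTransitive using (Star; ε; _◅_; _◅◅_; reverse)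
open import Relation.Binary.PropositionalEquality as ≡ using (_≡_; _≢_; _≗_; cong; cong₂; subst)
open import Relation.Nullary using (¬_; yes; no; contradiction)
open import Relation.Nullary.Decidable using (map′; ⌊_⌋; _×-dec_; _→-dec_)
import Relation.Unary as U

-- Forgetting the bottom chord is not the deletion of a fixed chord, because the bottom changes
-- whenever it is closed. The forgetting is therefore done on states, not on diagrams: two maps `M`
-- and `L`, with and without the bottom chord, are run in parallel, and only `M 1` and `L 0`, both
-- about the oldest chord above the bottom, need not agree. Diagrams enter through a single
-- bijection, the deletion of the chord that closes first, after which the first h points still open
-- chords. The weight x of a top chord is a parameter of the enumeration, so that u, 1 + uv and 1
-- are three of its values and a substituted series is again a sum over diagrams. The path sums live
-- in a semiring without subtraction, so the equation for C is first proved with its correction on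
-- the left.

-- Histories of a diagram

-- L p tells whether a closed interval starting at p is forbidden.  After the
-- chord of i has been closed at point h + 1 and both its points have been
-- removed, an interval starting at an open chord younger than i is no longer
-- closed, and point p ≥ h was p + 2 before.
closeStarts : (ℕ → Bool) → ℕ → ℕ → ℕ → Bool
closeStarts L h i p = if p <ᵇ h then (p <ᵇ suc i) ∧ L p else L (2 ℕ.+ p)

-- Closing i at height h + 1 completes the forbidden interval [h , h + 2).
detaches : ℕ → ℕ → (ℕ → Bool) → Bool
detaches h i L = (0 <ᵇ h) ∧ (i ≡ᵇ h) ∧ L h

closeStarts-cong : ∀ {L M} h i → L ≗ M → closeStarts L h i ≗ closeStarts M h i
closeStarts-cong h i L≗M p with p <ᵇ h
... | true  = cong ((p <ᵇ suc i) ∧_) (L≗M p)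
... | false = L≗M (2 ℕ.+ p)

<ᵇ-false : ∀ {h p} → h ≤ p → (p <ᵇ h) ≡ false
<ᵇ-false z≤n       = ≡.refl
<ᵇ-false (s≤s h≤p) = <ᵇ-false h≤p

-- M describes the open chords together with a bottom chord, L the same chords
-- without it; φ is the value at all points not yet read.
record Lift (φ : Bool) (h : ℕ) (M L : ℕ → Bool) : Set where
  field
    bottom : M 0 ≡ true
    above  : ∀ p → M (2 ℕ.+ p) ≡ L (suc p)
    beyond : ∀ p → h ≤ p → M (suc p) ≡ φ × L p ≡ φ

-- The bottom chord has not crossed anything.
record Fresh (φ : Bool) (h : ℕ) (M L : ℕ → Bool) : Set where
  field
    lift   : Lift φ h M L
    second : M 1 ≡ true
    first  : L 0 ≡ true

-- No forbidden interval starts at the next oldest open chord; for connected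
-- diagrams this means that it is already linked to the bottom chord.
record Merged (φ : Bool) (h : ℕ) (M L : ℕ → Bool) : Set where
  field
    lift   : Lift φ h M L
    second : 0 < h → M 1 ≡ false

open Lift

lift-open : ∀ {φ h M L} → Lift φ h M L → Lift φ (suc h) M L
lift-open l = record
  { bottom = bottom l ; above = above l
  ; beyond = λ p h<p → beyond l p (ℕ.<⇒≤ h<p) }

lift-close : ∀ {φ h M L} i → Lift φ (suc h) M L → Lift φ h (closeStarts M (suc h) (suc i)) (closeStarts L h i)
lift-close {h = h} {M} {L} i l = record
  { bottom = bottom l ; above = above′ ; beyond = beyond′ }
  where
  above′ : ∀ p → closeStarts M (suc h) (suc i) (2 ℕ.+ p) ≡ closeStarts L h i (suc p)
  above′ p with suc p <ᵇ h
  ... | true  = cong ((suc p <ᵇ suc i) ∧_) (above l p)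
  ... | false = above l (2 ℕ.+ p)
  beyond′ : ∀ p → h ≤ p → closeStarts M (suc h) (suc i) (suc p) ≡ _ × closeStarts L h i p ≡ _
  beyond′ p h≤p rewrite <ᵇ-false h≤p = beyond l (2 ℕ.+ p) (s≤s (ℕ.m≤n⇒m≤1+n h≤p))

-- Once the bottom chord is closed, the oldest chord of `L` becomes the bottom of `M`. No other open
-- chord can start a closed interval any more, so both maps are false there, exactly as when chord 0
-- of `L` is closed.
lift-close-bottom : ∀ {φ h M L} → Lift φ (suc h) M L → Lift φ h (closeStarts M (suc h) 0) (closeStarts L h 0)
lift-close-bottom {h = h} {M} {L} l = record
  { bottom = bottom l ; above = above′ ; beyond = beyond′ }
  where
  above′ : ∀ p → closeStarts M (suc h) 0 (2 ℕ.+ p) ≡ closeStarts L h 0 (suc p)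
  above′ p with suc p <ᵇ h
  ... | true  = ≡.refl
  ... | false = above l (2 ℕ.+ p)
  beyond′ : ∀ p → h ≤ p → closeStarts M (suc h) 0 (suc p) ≡ _ × closeStarts L h 0 p ≡ _
  beyond′ p h≤p rewrite <ᵇ-false h≤p = beyond l (2 ℕ.+ p) (s≤s (ℕ.m≤n⇒m≤1+n h≤p))

merged-open : ∀ {φ h M L} → Merged φ (suc h) M L → Merged φ (2 ℕ.+ h) M L
merged-open m = record { lift = lift-open (Merged.lift m) ; second = λ _ → Merged.second m (s≤s z≤n) }

merged-close : ∀ {φ h M L} i → Merged φ (suc h) M L →
               Merged φ h (closeStarts M (suc h) (suc i)) (closeStarts L h i)
merged-close i m = record
  { lift   = lift-close i (Merged.lift m)
  ; second = λ { (s≤s _) → Merged.second m (s≤s z≤n) } }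

-- This is the passage from `Fresh` to `Merged`: the closed chord crosses every chord still open,
-- among them the new bottom and its successor.
merged-close-bottom : ∀ {φ h M L} → Lift φ (suc h) M L →
                      Merged φ h (closeStarts M (suc h) 0) (closeStarts L h 0)
merged-close-bottom l = record { lift = lift-close-bottom l ; second = λ { (s≤s _) → ≡.refl } }

fresh-open : ∀ {φ h M L} → Fresh φ h M L → Fresh φ (suc h) M L
fresh-open f = record { lift = lift-open (Fresh.lift f) ; second = Fresh.second f ; first = Fresh.first f }

-- Closing a single chord above the bottom would complete a forbidden interval; hence at least two
-- are assumed.
fresh-close : ∀ {φ h M L} i → Fresh φ (2 ℕ.+ h) M L →
              Fresh φ (suc h) (closeStarts M (2 ℕ.+ h) (suc i)) (closeStarts L (suc h) i)
fresh-close i f = record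
  { lift = lift-close i (Fresh.lift f) ; second = Fresh.second f ; first = Fresh.first f }

detaches-0 : ∀ h L → detaches h 0 L ≡ false
detaches-0 zero    L = ≡.refl
detaches-0 (suc h) L = ≡.refl

-- The chord next to the bottom is also the youngest only when two chords are open, and then
-- `Merged` has discarded its start.
merged-detaches-1 : ∀ {φ} h {M L} → Merged φ (suc h) M L → detaches (suc h) 1 M ≡ false
merged-detaches-1 zero    m = Merged.second m (s≤s z≤n)
merged-detaches-1 (suc h) m = ≡.refl

detaches-above : ∀ {φ h M L} (j : Fin h) → Lift φ (suc h) M L →
  detaches (suc h) (2 ℕ.+ toℕ j) M ≡ detaches h (suc (toℕ j)) L
detaches-above {h = suc h} j l = cong ((toℕ j ≡ᵇ h) ∧_) (above l h)

-- Weighted path sums and their cut at the first return to height 1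

module Paths (R : CommutativeSemiring 0ℓ 0ℓ) (v : CommutativeSemiring.Carrier R) where

  open CommutativeSemiring R hiding (zero)
  open import Algebra.Properties.CommutativeSemigroup +-commutativeSemigroup using (interchange)
  open import Algebra.Properties.Semiring.Exp semiring using (_^_)
  open import Algebra.Properties.Semiring.Sum semiring
  open import Algebra.Solver.Ring.NaturalCoefficients.Default R
  open import Relation.Binary.Reasoning.Setoid setoid

  factor : Carrier → ℕ → ℕ → Carrier
  factor x h zero    = x * v ^ h
  factor x h (suc i) = v ^ (h ∸ suc i)

  -- pathSum x k h L is the total weight of the ways to read on with h open
  -- chords and k openings to come.  Returning to height 0 too early is
  -- excluded, since it completes a closed interval starting at 0.
  pathSum : Carrier → ℕ → ℕ → (ℕ → Bool) → Carrier
  closing : Carrier → ∀ k h → (ℕ → Bool) → Fin (suc h) → Carrier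

  pathSum x zero    zero    L = 1#
  pathSum x (suc k) zero    L = 0#
  pathSum x zero    (suc h) L = 0# + sum (closing x zero h L)
  pathSum x (suc k) (suc h) L = pathSum x k (2 ℕ.+ h) L + sum (closing x (suc k) h L)

  closing x k h L i =
    if detaches h (toℕ i) L then 0#
    else factor x h (toℕ i) * pathSum x k h (closeStarts L h (toℕ i))

  if-cong : ∀ {b b′ x x′} → b ≡ b′ → x ≈ x′ → (if b then 0# else x) ≈ (if b′ then 0# else x′)
  if-cong {true}  ≡.refl x≈x′ = refl
  if-cong {false} ≡.refl x≈x′ = x≈x′

  if-+-cong : ∀ {b b′ x x′ x″} → b ≡ b′ → x + x′ ≈ x″ →
    (if b then 0# else x) + (if b′ then 0# else x′) ≈ (if b′ then 0# else x″)
  if-+-cong {true}  ≡.refl eq = +-identityˡ 0#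
  if-+-cong {false} ≡.refl eq = eq

  -- Multiplication by z on coefficient sequences; `conv` is the Cauchy product.
  shift : (ℕ → Carrier) → ℕ → Carrier
  shift f zero    = 0#
  shift f (suc n) = f n

  conv : (ℕ → Carrier) → (ℕ → Carrier) → ℕ → Carrier
  conv f g n = ∑[ k ≤ n ] (f (toℕ k) * g (n ∸ toℕ k))

  pathSum-suc : ∀ x k h L →
    pathSum x k (suc h) L ≈ shift (λ k → pathSum x k (2 ℕ.+ h) L) k + sum (closing x k h L)
  pathSum-suc x zero    h L = refl
  pathSum-suc x (suc k) h L = refl

  pathSum-cong : ∀ x k h {L M} → L ≗ M → pathSum x k h L ≈ pathSum x k h M
  closing-cong : ∀ x k h {L M} → L ≗ M → ∀ i → closing x k h L i ≈ closing x k h M i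

  pathSum-cong x zero    zero    L≗M = refl
  pathSum-cong x (suc k) zero    L≗M = refl
  pathSum-cong x zero    (suc h) L≗M = +-congˡ (sum-cong-≋ (closing-cong x zero h L≗M))
  pathSum-cong x (suc k) (suc h) L≗M =
    +-cong (pathSum-cong x k (2 ℕ.+ h) L≗M) (sum-cong-≋ (closing-cong x (suc k) h L≗M))

  closing-cong x k h {L} {M} L≗M i rewrite L≗M h with detaches h (toℕ i) M
  ... | true  = refl
  ... | false = *-congˡ (pathSum-cong x k h (closeStarts-cong h (toℕ i) L≗M))

  shift-cong : ∀ {f g} → (∀ n → f n ≈ g n) → ∀ n → shift f n ≈ shift g n
  shift-cong f≈g zero    = refl
  shift-cong f≈g (suc n) = f≈g n

  conv-congˡ : ∀ {f f′} g n → (∀ k → f k ≈ f′ k) → conv f g n ≈ conv f′ g n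
  conv-congˡ g n f≈f′ = sum-cong-≋ {suc n} (λ k → *-congʳ {g (n ∸ toℕ k)} (f≈f′ (toℕ k)))

  conv-+ : ∀ f f′ g n → conv (λ k → f k + f′ k) g n ≈ conv f g n + conv f′ g n
  conv-+ f f′ g n =
    trans (sum-cong-≋ {suc n} (λ k → distribʳ (g (n ∸ toℕ k)) (f (toℕ k)) (f′ (toℕ k))))
          (∑-distrib-+ {suc n} (λ k → f (toℕ k) * g (n ∸ toℕ k)) (λ k → f′ (toℕ k) * g (n ∸ toℕ k)))

  conv-* : ∀ x f g n → conv (λ k → x * f k) g n ≈ x * conv f g n
  conv-* x f g n =
    trans (sum-cong-≋ {suc n} (λ k → *-assoc x (f (toℕ k)) (g (n ∸ toℕ k))))
          (sym (*-distribˡ-sum {suc n} x (λ k → f (toℕ k) * g (n ∸ toℕ k))))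

  conv-0 : ∀ g n → conv (λ _ → 0#) g n ≈ 0#
  conv-0 g n = trans (sum-cong-≋ {suc n} (λ k → zeroˡ (g (n ∸ toℕ k)))) (sum-replicate-zero (suc n))

  conv-sum : ∀ {m} (f : Fin m → ℕ → Carrier) g n →
             conv (λ k → ∑[ i < m ] f i k) g n ≈ ∑[ i < m ] conv (f i) g n
  conv-sum {m} f g n =
    trans (sum-cong-≋ {suc n} (λ k → *-distribʳ-sum {m} (g (n ∸ toℕ k)) (λ i → f i (toℕ k))))
          (∑-comm {suc n} {m} (λ k i → f i (toℕ k) * g (n ∸ toℕ k)))

  conv-shift : ∀ f g n → conv (shift f) g n ≈ shift (conv f g) n
  conv-shift f g zero    = trans (+-identityʳ _) (zeroˡ _)
  conv-shift f g (suc n) = trans (+-congʳ (zeroˡ _)) (+-identityˡ _)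

  module _ (g : ℕ → Carrier) where

    convClosing : Carrier → ∀ n h → (ℕ → Bool) → Fin (suc h) → Carrier
    convClosing x n h L i =
      if detaches h (toℕ i) L then 0#
      else factor x h (toℕ i) * conv (λ k → pathSum x k h (closeStarts L h (toℕ i))) g n

    conv-closing : ∀ x n h L i → conv (λ k → closing x k h L i) g n ≈ convClosing x n h L i
    conv-closing x n h L i with detaches h (toℕ i) L
    ... | true  = conv-0 g n
    ... | false = conv-* (factor x h (toℕ i)) (λ k → pathSum x k h (closeStarts L h (toℕ i))) g n

    -- Convolution with g is linear and commutes with `shift`, so it inherits the recursion of
    -- `pathSum`. Only the value at height 0 changes, from 1 or 0 to `g n`.
    conv-pathSum-suc : ∀ x n h L →
      conv (λ k → pathSum x k (suc h) L) g n ≈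
      shift (conv (λ k → pathSum x k (2 ℕ.+ h) L) g) n + sum (convClosing x n h L)
    conv-pathSum-suc x n h L = begin
      conv (λ k → pathSum x k (suc h) L) g n
        ≈⟨ conv-congˡ g n (λ k → pathSum-suc x k h L) ⟩
      conv (λ k → shift (λ k → pathSum x k (2 ℕ.+ h) L) k + sum (closing x k h L)) g n
        ≈⟨ conv-+ (shift (λ k → pathSum x k (2 ℕ.+ h) L)) (λ k → sum (closing x k h L)) g n ⟩
      conv (shift (λ k → pathSum x k (2 ℕ.+ h) L)) g n + conv (λ k → sum (closing x k h L)) g n
        ≈⟨ +-cong (conv-shift (λ k → pathSum x k (2 ℕ.+ h) L) g n)
                  (trans (conv-sum (λ i k → closing x k h L i) g n) (sum-cong-≋ (conv-closing x n h L))) ⟩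
      shift (conv (λ k → pathSum x k (2 ℕ.+ h) L) g) n + sum (convClosing x n h L) ∎

    conv-pathSum-0 : ∀ x n L → conv (λ k → pathSum x k 0 L) g n ≈ g n
    conv-pathSum-0 x zero L = trans (+-identityʳ _) (*-identityˡ _)
    conv-pathSum-0 x (suc n) L = begin
      1# * g (suc n) + conv (λ _ → 0#) g n ≈⟨ +-cong (*-identityˡ _) (conv-0 g n) ⟩
      g (suc n) + 0#                       ≈⟨ +-identityʳ _ ⟩
      g (suc n)                            ∎

  module FirstReturn (u : Carrier) (φ : Bool) (L⁰ : ℕ → Bool)
    (L⁰0 : L⁰ 0 ≡ true) (L⁰φ : ∀ p → L⁰ (suc p) ≡ φ) where

    y : Carrier
    y = 1# + u * v

    -- The first point always opens a chord and is not counted in n, so this stands for the diagrams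
    -- with n + 1 chords, and equally for what follows a return to height 1.
    g : ℕ → Carrier
    g n = pathSum u n 1 L⁰

    expand-y : ∀ h a → u * (v * v ^ h) * a + v ^ h * a ≈ y * v ^ h * a
    expand-y h a = solve 4 (λ u v w a → u :* (v :* w) :* a :+ w :* a := (con 1 :+ u :* v) :* w :* a)
                     refl u v (v ^ h) a

    -- At height 1 only the bottom chord is open and the map remembers nothing of the past; the rest
    -- of the path is therefore counted by `g`.
    merged-base : ∀ {M L} → Merged φ 0 M L → M ≗ L⁰
    merged-base m zero    = ≡.trans (bottom (Merged.lift m)) (≡.sym L⁰0)
    merged-base m (suc p) = let M≡φ , _ = beyond (Merged.lift m) p z≤n in ≡.trans M≡φ (≡.sym (L⁰φ p))

    -- The paths are cut at the first return to height 1; y is the weight of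
    -- closing the oldest chord above the bottom one.
    merged-conv : ∀ n h {M L} → Merged φ h M L →
                  pathSum u n (suc h) M ≈ conv (λ k → pathSum y k h L) g n
    merged-open-conv : ∀ n h {M L} → Merged φ (suc h) M L →
      shift (λ n → pathSum u n (3 ℕ.+ h) M) n ≈ shift (conv (λ k → pathSum y k (2 ℕ.+ h) L) g) n
    merged-closing : ∀ n h {M L} → Merged φ (suc h) M L →
      sum (closing u n (suc h) M) ≈ sum (convClosing g y n h L)
    -- Closing the bottom chord or the next one leaves the same state above the bottom,
    -- `closeStarts L h 0`; two steps of `M` thus become one step of `L`, with their weights added.
    merged-first-two : ∀ n h {M L} → Merged φ (suc h) M L →
      closing u n (suc h) M zero + closing u n (suc h) M (suc zero) ≈ convClosing g y n h L zero
    merged-closing-above : ∀ n h {M L} → Merged φ (suc h) M L → ∀ (j : Fin h) →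
      closing u n (suc h) M (suc (suc j)) ≈ convClosing g y n h L (suc j)

    merged-conv n zero    {M} {L} m =
      trans (pathSum-cong u n 1 (merged-base m)) (sym (conv-pathSum-0 g y n L))
    merged-conv n (suc h) {M} {L} m = begin
      pathSum u n (2 ℕ.+ h) M
        ≈⟨ pathSum-suc u n (suc h) M ⟩
      shift (λ n → pathSum u n (3 ℕ.+ h) M) n + sum (closing u n (suc h) M)
        ≈⟨ +-cong (merged-open-conv n h m) (merged-closing n h m) ⟩
      shift (conv (λ k → pathSum y k (2 ℕ.+ h) L) g) n + sum (convClosing g y n h L)
        ≈⟨ conv-pathSum-suc g y n h L ⟨
      conv (λ k → pathSum y k (suc h) L) g n ∎

    merged-open-conv zero    h m = refl
    merged-open-conv (suc n) h m = merged-conv n (2 ℕ.+ h) (merged-open m)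

    merged-closing n h {M} {L} m = begin
      closing u n (suc h) M zero + (closing u n (suc h) M (suc zero) + rest)
        ≈⟨ +-assoc _ _ _ ⟨
      closing u n (suc h) M zero + closing u n (suc h) M (suc zero) + rest
        ≈⟨ +-cong (merged-first-two n h m) (sum-cong-≋ (merged-closing-above n h m)) ⟩
      convClosing g y n h L zero + sum (λ j → convClosing g y n h L (suc j)) ∎
      where
      rest : Carrier
      rest = sum {h} (λ j → closing u n (suc h) M (suc (suc j)))

    merged-first-two n h {M} {L} m = begin
      closing u n (suc h) M zero + closing u n (suc h) M (suc zero)
        ≈⟨ +-cong (if-cong (≡.refl {x = false}) (*-congˡ (merged-conv n h (merged-close-bottom (Merged.lift m)))))
                  (if-cong (merged-detaches-1 h m) (*-congˡ (merged-conv n h (merged-close 0 m)))) ⟩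
      u * (v * v ^ h) * a + v ^ h * a
        ≈⟨ expand-y h a ⟩
      y * v ^ h * a
        ≈⟨ if-cong (detaches-0 h L) refl ⟨
      convClosing g y n h L zero ∎
      where
      a : Carrier
      a = conv (λ k → pathSum y k h (closeStarts L h 0)) g n

    merged-closing-above n h {M} {L} m j =
      if-cong (detaches-above j (Merged.lift m)) (*-congˡ (merged-conv n h (merged-close (suc (toℕ j)) m)))

    -- Here the paths that return without closing the bottom chord, counted by
    -- pathSum 1#, are forbidden.  They are added on the left so that the
    -- identity holds in a semiring.
    fresh-conv : ∀ n h {M L} → Fresh φ (suc h) M L →
      pathSum u n (2 ℕ.+ h) M + conv (λ k → pathSum 1# k (suc h) L) g n ≈
      conv (λ k → pathSum y k (suc h) L) g n
    fresh-open-conv : ∀ n h {M L} → Fresh φ (suc h) M L →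
      shift (λ n → pathSum u n (3 ℕ.+ h) M) n + shift (conv (λ k → pathSum 1# k (2 ℕ.+ h) L) g) n ≈
      shift (conv (λ k → pathSum y k (2 ℕ.+ h) L) g) n
    fresh-closing : ∀ n h {M L} → Fresh φ (suc h) M L →
      sum (closing u n (suc h) M) + sum (convClosing g 1# n h L) ≈ sum (convClosing g y n h L)
    fresh-first-two : ∀ n h {M L} → Fresh φ (suc h) M L →
      closing u n (suc h) M zero + closing u n (suc h) M (suc zero) + convClosing g 1# n h L zero ≈
      convClosing g y n h L zero
    fresh-closing-above : ∀ n h {M L} → Fresh φ (suc h) M L → ∀ (j : Fin h) →
      closing u n (suc h) M (suc (suc j)) + convClosing g 1# n h L (suc j) ≈ convClosing g y n h L (suc j)

    fresh-conv n h {M} {L} f = begin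
      pathSum u n (2 ℕ.+ h) M + conv (λ k → pathSum 1# k (suc h) L) g n
        ≈⟨ +-cong (pathSum-suc u n (suc h) M) (conv-pathSum-suc g 1# n h L) ⟩
      (shift (λ n → pathSum u n (3 ℕ.+ h) M) n + sum (closing u n (suc h) M)) +
      (shift (conv (λ k → pathSum 1# k (2 ℕ.+ h) L) g) n + sum (convClosing g 1# n h L))
        ≈⟨ interchange _ _ _ _ ⟩
      (shift (λ n → pathSum u n (3 ℕ.+ h) M) n + shift (conv (λ k → pathSum 1# k (2 ℕ.+ h) L) g) n) +
      (sum (closing u n (suc h) M) + sum (convClosing g 1# n h L))
        ≈⟨ +-cong (fresh-open-conv n h f) (fresh-closing n h f) ⟩
      shift (conv (λ k → pathSum y k (2 ℕ.+ h) L) g) n + sum (convClosing g y n h L)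
        ≈⟨ conv-pathSum-suc g y n h L ⟨
      conv (λ k → pathSum y k (suc h) L) g n ∎

    fresh-open-conv zero    h f = +-identityˡ 0#
    fresh-open-conv (suc n) h f = fresh-conv n (suc h) (fresh-open f)

    fresh-closing n h {M} {L} f = begin
      (T zero + (T (suc zero) + sum (λ j → T (suc (suc j))))) + (V zero + sum (λ j → V (suc j)))
        ≈⟨ solve 5 (λ a b c d e → (a :+ (b :+ c)) :+ (d :+ e) := (a :+ b :+ d) :+ (c :+ e)) refl
             (T zero) (T (suc zero)) (sum (λ j → T (suc (suc j)))) (V zero) (sum (λ j → V (suc j))) ⟩
      (T zero + T (suc zero) + V zero) + (sum (λ j → T (suc (suc j))) + sum (λ j → V (suc j)))
        ≈⟨ +-cong (fresh-first-two n h f)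
             (trans (sym (∑-distrib-+ (λ j → T (suc (suc j))) (λ j → V (suc j))))
                    (sum-cong-≋ (fresh-closing-above n h f))) ⟩
      convClosing g y n h L zero + sum (λ j → convClosing g y n h L (suc j)) ∎
      where
      T : Fin (2 ℕ.+ h) → Carrier
      T = closing u n (suc h) M
      V : Fin (suc h) → Carrier
      V = convClosing g 1# n h L

    -- Closing the only chord above the bottom is forbidden and contributes 0; the correction
    -- supplies the missing summand `a`. Its top weight is 1# because a chord closed under an open
    -- bottom chord is not a top chord.
    fresh-first-two n zero {M} {L} f = begin
      closing u n 1 M zero + closing u n 1 M (suc zero) + convClosing g 1# n 0 L zero
        ≈⟨ +-cong (+-cong (*-congˡ (merged-conv n 0 (merged-close-bottom (Fresh.lift f))))
                          (if-cong (Fresh.second f) refl))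
                  (*-congˡ (trans (conv-pathSum-0 g 1# n L) (sym (conv-pathSum-0 g y n L)))) ⟩
      u * (v * 1#) * a + 0# + 1# * 1# * a
        ≈⟨ solve 3 (λ u v a → u :* (v :* con 1) :* a :+ con 0 :+ con 1 :* con 1 :* a := (con 1 :+ u :* v) :* con 1 :* a)
             refl u v a ⟩
      y * 1# * a ∎
      where
      a : Carrier
      a = conv (λ k → pathSum y k 0 (closeStarts L 0 0)) g n
    -- Closing the bottom leads to a merged state. Closing the next chord keeps the state fresh, so
    -- the induction hypothesis combines `b` with the correction `c`.
    fresh-first-two n (suc h) {M} {L} f = begin
      u * (v * w) * pathSum u n (2 ℕ.+ h) M₀ + w * b + 1# * w * c
        ≈⟨ +-congʳ (+-congʳ (*-congˡ (merged-conv n (suc h) (merged-close-bottom (Fresh.lift f))))) ⟩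
      u * (v * w) * a + w * b + 1# * w * c
        ≈⟨ solve 6 (λ u v w a b c → u :* (v :* w) :* a :+ w :* b :+ con 1 :* w :* c
                                     := u :* (v :* w) :* a :+ w :* (b :+ c))
             refl u v w a b c ⟩
      u * (v * w) * a + w * (b + c)
        ≈⟨ +-congˡ (*-congˡ (fresh-conv n h (fresh-close 0 f))) ⟩
      u * (v * w) * a + w * a
        ≈⟨ expand-y (suc h) a ⟩
      y * w * a ∎
      where
      M₀ : ℕ → Bool
      M₀ = closeStarts M (2 ℕ.+ h) 0
      w a b c : Carrier
      w = v ^ suc h
      a = conv (λ k → pathSum y k (suc h) (closeStarts L (suc h) 0)) g n
      b = pathSum u n (2 ℕ.+ h) (closeStarts M (2 ℕ.+ h) 1)
      c = conv (λ k → pathSum 1# k (suc h) (closeStarts L (suc h) 0)) g n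

    fresh-closing-above n (suc h) {M} {L} f j =
      if-+-cong (detaches-above j (Fresh.lift f))
        (trans (sym (distribˡ _ _ _)) (*-congˡ (fresh-conv n h (fresh-close (suc (toℕ j)) f))))

    monomial : ℕ → Carrier
    monomial zero    = u
    monomial (suc n) = 0#

    -- Closing the only open chord must end the path. An opening leaves the map unchanged, since the
    -- starts are indexed by position and the new point already has its value.
    first-step : ∀ n → g n ≈ monomial n + shift (λ k → pathSum u k 2 L⁰) n
    first-step zero = solve 1 (λ u → con 0 :+ (u :* con 1 :* con 1 :+ con 0) := u :+ con 0) refl u
    first-step (suc n) =
      solve 2 (λ u a → a :+ (u :* con 1 :* con 0 :+ con 0) := con 0 :+ a) refl u (pathSum u n 2 L⁰)

    -- After two openings no start has been lost, so `L⁰` serves both as the map with the bottom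
    -- chord and as the map without it.
    merged-equation : Merged φ 1 L⁰ L⁰ → ∀ n →
      g n ≈ monomial n + shift (conv (λ k → pathSum y k 1 L⁰) g) n
    merged-equation m n = trans (first-step n) (+-congˡ (shift-cong (λ k → merged-conv k 1 m) n))

    fresh-equation : Fresh φ 1 L⁰ L⁰ → ∀ n →
      g n + shift (conv (λ k → pathSum 1# k 1 L⁰) g) n ≈
      monomial n + shift (conv (λ k → pathSum y k 1 L⁰) g) n
    fresh-equation f n = begin
      g n + shift (conv (λ k → pathSum 1# k 1 L⁰) g) n
        ≈⟨ +-congʳ (first-step n) ⟩
      monomial n + shift (λ k → pathSum u k 2 L⁰) n + shift (conv (λ k → pathSum 1# k 1 L⁰) g) n
        ≈⟨ +-assoc _ _ _ ⟩
      monomial n + (shift (λ k → pathSum u k 2 L⁰) n + shift (conv (λ k → pathSum 1# k 1 L⁰) g) n)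
        ≈⟨ +-congˡ (combine n) ⟩
      monomial n + shift (conv (λ k → pathSum y k 1 L⁰) g) n ∎
      where
      combine : ∀ n → shift (λ k → pathSum u k 2 L⁰) n + shift (conv (λ k → pathSum 1# k 1 L⁰) g) n ≈
                      shift (conv (λ k → pathSum y k 1 L⁰) g) n
      combine zero    = +-identityˡ 0#
      combine (suc n) = fresh-conv n 0 f

module Weights (R : CommutativeSemiring 0ℓ 0ℓ) (v x : CommutativeSemiring.Carrier R) where

  open CommutativeSemiring R using (Carrier; _+_; _*_; 0#)
  open import Algebra.Properties.Semiring.Exp (CommutativeSemiring.semiring R) using () renaming (_^_ to _^ᴿ_)

  total : ∀ {m} → List (Table m) → Carrier
  total []       = 0#
  total (D ∷ Ds) = (x ^ᴿ top D) * (v ^ᴿ cr D) + total Ds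

-- Inserting a chord

lookup-ext : ∀ {A : Set} {n} {xs ys : Vec A n} → (∀ i → lookup xs i ≡ lookup ys i) → xs ≡ ys
lookup-ext {xs = xs} {ys} eq =
  ≡.trans (≡.sym (Vec.tabulate∘lookup xs)) (≡.trans (Vec.tabulate-cong eq) (Vec.tabulate∘lookup ys))

toℕ-punchIn-< : ∀ {n} (i : Fin (suc n)) (j : Fin n) → toℕ j < toℕ i → toℕ (punchIn i j) ≡ toℕ j
toℕ-punchIn-< (suc i) zero    _         = ≡.refl
toℕ-punchIn-< (suc i) (suc j) (s≤s j<i) = cong suc (toℕ-punchIn-< i j j<i)

toℕ-punchIn-≥ : ∀ {n} (i : Fin (suc n)) (j : Fin n) → toℕ i ≤ toℕ j → toℕ (punchIn i j) ≡ suc (toℕ j)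
toℕ-punchIn-≥ zero    j       _         = ≡.refl
toℕ-punchIn-≥ (suc i) (suc j) (s≤s i≤j) = cong suc (toℕ-punchIn-≥ i j i≤j)

Openers : ∀ {m} → ℕ → Table m → Set
Openers h D = ∀ a → toℕ a < h → a Fin.< lookup D a

Inside : ∀ {m} → ℕ → ℕ → Fin m → Set
Inside p q a = p ≤ toℕ a × toℕ a < q

Closed : ∀ {m} → ℕ → ℕ → Table m → Set
Closed p q D = ∀ a → Inside p q a → Inside p q (lookup D a)

-- For matchings, `L` true only at 0 gives indecomposability and `L` true everywhere gives
-- connectedness; the other maps arise when chords are deleted.
NoClosed : ∀ {m} → (ℕ → Bool) → Table m → Set
NoClosed {m} L D = ∀ p q → L p ≡ true → p < q → q ≤ m → Closed p q D → p ≡ 0 × q ≡ m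

openers? : ∀ {m} h → U.Decidable (Openers {m} h)
openers? h D = Fin.all? λ a → (toℕ a ℕ.<? h) →-dec (a Fin.<? lookup D a)

inside? : ∀ {m} p q → U.Decidable (Inside {m} p q)
inside? p q a = (p ℕ.≤? toℕ a) ×-dec (toℕ a ℕ.<? q)

closed? : ∀ {m} p q → U.Decidable (Closed {m} p q)
closed? p q D = Fin.all? λ a → inside? p q a →-dec inside? p q (lookup D a)

noClosed? : ∀ {m} L → U.Decidable (NoClosed {m} L)
noClosed? {m} L D =
  map′ (λ N p q Lp p<q q≤m c → N (s≤s (ℕ.≤-trans (ℕ.<⇒≤ p<q) q≤m)) (s≤s q≤m) Lp p<q q≤m c)
       (λ N {p} _ {q} _ → N p q)
    (ℕ.allUpTo? (λ p → ℕ.allUpTo? (λ q →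
       (L p Bool.≟ true) →-dec (p ℕ.<? q) →-dec (q ℕ.≤? m) →-dec closed? p q D →-dec
       ((p ℕ.≟ 0) ×-dec (q ℕ.≟ m))) (suc m)) (suc m))

Admissible : ∀ {m} → ℕ → (ℕ → Bool) → Table m → Set
Admissible h L D = IsMatching D × Openers h D × NoClosed L D

admissible? : ∀ {m} h L → U.Decidable (Admissible {m} h L)
admissible? h L D = isMatching? D ×-dec openers? h D ×-dec noClosed? L D

-- If two of the first h points were partners, each would lie to the left of the other.
opener-≥ : ∀ {m h} (D : Table m) → IsMatching D → Openers h D → ∀ a → toℕ a < h → h ≤ toℕ (lookup D a)
opener-≥ {h = h} D M O a a<h with h ℕ.≤? toℕ (lookup D a)
... | yes h≤Da = h≤Da
... | no  h≰Da = contradiction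
  (subst (lookup D a Fin.<_) (proj₁ (M a)) (O (lookup D a) (ℕ.≰⇒> h≰Da)))
  (ℕ.<⇒≯ (O a a<h))

<ᵇ-true : ∀ {m n} → m < n → (m <ᵇ n) ≡ true
<ᵇ-true m<n = Equivalence.to Bool.T-≡ (ℕ.<⇒<ᵇ m<n)

<ᵇ-true⁻ : ∀ {m n} → (m <ᵇ n) ≡ true → m < n
<ᵇ-true⁻ {m} {n} eq = ℕ.<ᵇ⇒< m n (Equivalence.from Bool.T-≡ eq)

closeStarts-< : ∀ L {h} i {p} → p < h → closeStarts L h i p ≡ (p <ᵇ suc i) ∧ L p
closeStarts-< L i p<h rewrite <ᵇ-true p<h = ≡.refl

closeStarts-≥ : ∀ L {h} i {p} → h ≤ p → closeStarts L h i p ≡ L (2 ℕ.+ p)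
closeStarts-≥ L i h≤p rewrite <ᵇ-false h≤p = ≡.refl

-- Unlike `detaches`, this tests the number m of remaining points: at h = 0 a chord closed before
-- the end is caught too, a case that `pathSum` excludes by its value at height 0.
detached : ℕ → ℕ → ℕ → (ℕ → Bool) → Bool
detached m h i L = (0 <ᵇ m) ∧ (i ≡ᵇ h) ∧ L h

detached-true : ∀ {m h L} → 0 < m → L h ≡ true → detached m h h L ≡ true
detached-true {h = h} (s≤s _) Lh rewrite Lh | Equivalence.to Bool.T-≡ (ℕ.≡⇒≡ᵇ h h ≡.refl) = ≡.refl

detached-true⁻ : ∀ {m h i L} → detached m h i L ≡ true → 0 < m × i ≡ h × L h ≡ true
detached-true⁻ {suc m} {h} {i} eq with i ≡ᵇ h in i≡h
... | true = s≤s z≤n , ℕ.≡ᵇ⇒≡ i h (Equivalence.from Bool.T-≡ i≡h) , eq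

module Insertion {m h i : ℕ} (i≤h : i ≤ h) (h≤m : h ≤ m) where

  -- The new chord joins the points i and h + 1 of the larger diagram.
  right : Fin (2 ℕ.+ m)
  right = fromℕ< (s≤s (s≤s h≤m))

  gap : Fin (suc m)
  gap = fromℕ< (s≤s (ℕ.≤-trans i≤h h≤m))

  left : Fin (2 ℕ.+ m)
  left = punchIn right gap

  ι : Fin m → Fin (2 ℕ.+ m)
  ι a = punchIn right (punchIn gap a)

  insertChord : Table m → Table (2 ℕ.+ m)
  insertChord D = insertAt (insertAt (Vec.map ι D) gap right) right left

  toℕ-right : toℕ right ≡ suc h
  toℕ-right = Fin.toℕ-fromℕ< (s≤s (s≤s h≤m))

  toℕ-gap : toℕ gap ≡ i
  toℕ-gap = Fin.toℕ-fromℕ< (s≤s (ℕ.≤-trans i≤h h≤m))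

  toℕ-left : toℕ left ≡ i
  toℕ-left = ≡.trans (toℕ-punchIn-< right gap gap<right) toℕ-gap
    where
    gap<right : toℕ gap < toℕ right
    gap<right rewrite toℕ-gap | toℕ-right = s≤s i≤h

  left<right : left Fin.< right
  left<right rewrite toℕ-left | toℕ-right = s≤s i≤h

  data Position (a : Fin m) : Set where
    before  : toℕ a < i → toℕ (ι a) ≡ toℕ a → Position a
    between : i ≤ toℕ a → toℕ a < h → toℕ (ι a) ≡ suc (toℕ a) → Position a
    after   : h ≤ toℕ a → toℕ (ι a) ≡ 2 ℕ.+ toℕ a → Position a

  position : ∀ a → Position a
  position a with toℕ a ℕ.<? i | toℕ a ℕ.<? h
  ... | yes a<i | _ = before a<i (≡.trans (toℕ-punchIn-< right _ lt) eq)
    where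
    eq : toℕ (punchIn gap a) ≡ toℕ a
    eq = toℕ-punchIn-< gap a (subst (toℕ a <_) (≡.sym toℕ-gap) a<i)
    lt : toℕ (punchIn gap a) < toℕ right
    lt rewrite eq | toℕ-right = ℕ.m<n⇒m<1+n (ℕ.<-≤-trans a<i i≤h)
  ... | no a≮i | yes a<h = between (ℕ.≮⇒≥ a≮i) a<h (≡.trans (toℕ-punchIn-< right _ lt) eq)
    where
    eq : toℕ (punchIn gap a) ≡ suc (toℕ a)
    eq = toℕ-punchIn-≥ gap a (subst (_≤ toℕ a) (≡.sym toℕ-gap) (ℕ.≮⇒≥ a≮i))
    lt : toℕ (punchIn gap a) < toℕ right
    lt rewrite eq | toℕ-right = s≤s a<h
  ... | no a≮i | no a≮h = after (ℕ.≮⇒≥ a≮h) (≡.trans (toℕ-punchIn-≥ right _ ge) (cong suc eq))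
    where
    eq : toℕ (punchIn gap a) ≡ suc (toℕ a)
    eq = toℕ-punchIn-≥ gap a (subst (_≤ toℕ a) (≡.sym toℕ-gap) (ℕ.≮⇒≥ a≮i))
    ge : toℕ right ≤ toℕ (punchIn gap a)
    ge rewrite eq | toℕ-right = s≤s (ℕ.≮⇒≥ a≮h)

  data Point : Fin (2 ℕ.+ m) → Set where
    isLeft  : Point left
    isRight : Point right
    old     : ∀ a → Point (ι a)

  point : ∀ x → Point x
  point x with right Fin.≟ x
  ... | yes ≡.refl = isRight
  ... | no  r≢x with gap Fin.≟ punchOut r≢x
  ...   | yes g≡ = subst Point (≡.trans (cong (punchIn right) g≡) (Fin.punchIn-punchOut r≢x)) isLeft
  ...   | no  g≢ = subst Point (≡.trans (cong (punchIn right) (Fin.punchIn-punchOut g≢)) (Fin.punchIn-punchOut r≢x))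
                     (old (punchOut g≢))

  ι-injective : ∀ {a b} → ι a ≡ ι b → a ≡ b
  ι-injective = Fin.punchIn-injective gap _ _ ∘ Fin.punchIn-injective right _ _

  ι≢right : ∀ {a} → ι a ≢ right
  ι≢right = Fin.punchInᵢ≢i right _

  ι≢left : ∀ {a} → ι a ≢ left
  ι≢left = Fin.punchInᵢ≢i gap _ ∘ Fin.punchIn-injective right _ _

  left≢right : left ≢ right
  left≢right = Fin.punchInᵢ≢i right gap

  ι-cancel-< : ∀ {a b} → ι a Fin.< ι b → a Fin.< b
  ι-cancel-< ιa<ιb = ℕ.≰⇒> λ b≤a →
    ℕ.<⇒≱ ιa<ιb (Fin.punchIn-mono-≤ right _ _ (Fin.punchIn-mono-≤ gap _ _ b≤a))

  ι-mono-< : ∀ {a b} → a Fin.< b → ι a Fin.< ι b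
  ι-mono-< a<b = ℕ.≰⇒> λ ιb≤ιa →
    ℕ.<⇒≱ a<b (Fin.punchIn-cancel-≤ gap _ _ (Fin.punchIn-cancel-≤ right _ _ ιb≤ιa))

  module _ (D : Table m) where

    withLeft : Vec (Fin (2 ℕ.+ m)) (suc m)
    withLeft = insertAt (Vec.map ι D) gap right

    lookup-right : lookup (insertChord D) right ≡ left
    lookup-right = Vec.insertAt-lookup withLeft right left

    lookup-left : lookup (insertChord D) left ≡ right
    lookup-left = ≡.trans (Vec.insertAt-punchIn withLeft right left gap)
                        (Vec.insertAt-lookup (Vec.map ι D) gap right)

    lookup-ι : ∀ a → lookup (insertChord D) (ι a) ≡ ι (lookup D a)
    lookup-ι a = ≡.trans (Vec.insertAt-punchIn withLeft right left (punchIn gap a))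
      (≡.trans (Vec.insertAt-punchIn (Vec.map ι D) gap right a) (Vec.lookup-map a ι D))

    insert-matching : IsMatching D → IsMatching (insertChord D)
    insert-matching M x with point x
    ... | isLeft  rewrite lookup-left  = lookup-right , left≢right ∘ ≡.sym
    ... | isRight rewrite lookup-right = lookup-left , left≢right
    ... | old a   rewrite lookup-ι a | lookup-ι (lookup D a) =
      cong ι (proj₁ (M a)) , proj₂ (M a) ∘ ι-injective

    insert-matching⁻ : IsMatching (insertChord D) → IsMatching D
    insert-matching⁻ M a =
      ι-injective (≡.trans (≡.sym (≡.trans (cong (lookup (insertChord D)) (lookup-ι a)) (lookup-ι (lookup D a)))) (proj₁ (M (ι a)))) ,
      λ Da≡a → proj₂ (M (ι a)) (≡.trans (lookup-ι a) (cong ι Da≡a))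

    insert-openers : Openers h D → Openers (suc h) (insertChord D)
    insert-openers O x x≤h with point x
    ... | isLeft  rewrite lookup-left  = left<right
    ... | isRight = contradiction (subst (_< suc h) toℕ-right x≤h) (ℕ.<-irrefl ≡.refl)
    ... | old a   rewrite lookup-ι a = ι-mono-< (O a (a<h (position a)))
      where
      a<h : Position a → toℕ a < h
      a<h (before a<i _)    = ℕ.<-≤-trans a<i i≤h
      a<h (between _ a<h _) = a<h
      a<h (after h≤a eq)    = contradiction (subst (_< suc h) eq x≤h) (ℕ.≤⇒≯ (s≤s (ℕ.m≤n⇒m≤1+n h≤a)))

    insert-openers⁻ : Openers (suc h) (insertChord D) → Openers h D
    insert-openers⁻ O a a<h = ι-cancel-< (subst (ι a Fin.<_) (lookup-ι a) (O (ι a) (ιa≤h (position a))))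
      where
      ιa≤h : Position a → toℕ (ι a) < suc h
      ιa≤h (before _ eq)    rewrite eq = ℕ.m<n⇒m<1+n a<h
      ιa≤h (between _ _ eq) rewrite eq = s≤s a<h
      ιa≤h (after h≤a _)    = contradiction a<h (ℕ.≤⇒≯ h≤a)

  insertChord-injective : ∀ {D E} → insertChord D ≡ insertChord E → D ≡ E
  insertChord-injective {D} {E} eq = lookup-ext λ a → ι-injective
    (≡.trans (≡.sym (lookup-ι D a)) (≡.trans (cong (λ F → lookup F (ι a)) eq) (lookup-ι E a)))

  -- Since `left` and `right` are partners, the partner of an old point is old, and the smaller
  -- table can be read off.
  removeChord : ∀ {D} → IsMatching D → lookup D right ≡ left → ∃ λ E → D ≡ insertChord E
  removeChord {D} M Dr≡l = E , lookup-ext agree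
    where
    Dl≡r : lookup D left ≡ right
    Dl≡r = ≡.trans (cong (lookup D) (≡.sym Dr≡l)) (proj₁ (M right))
    image : ∀ a → ∃ λ b → lookup D (ι a) ≡ ι b
    image a with lookup D (ι a) in eq | point (lookup D (ι a))
    ... | _ | isLeft  = contradiction (≡.trans (≡.sym (proj₁ (M (ι a)))) (≡.trans (cong (lookup D) eq) Dl≡r)) ι≢right
    ... | _ | isRight = contradiction (≡.trans (≡.sym (proj₁ (M (ι a)))) (≡.trans (cong (lookup D) eq) Dr≡l)) ι≢left
    ... | _ | old b   = b , ≡.refl
    E : Table m
    E = tabulate (proj₁ ∘ image)
    agree : ∀ x → lookup D x ≡ lookup (insertChord E) x
    agree x with point x
    ... | isLeft  = ≡.trans Dl≡r (≡.sym (lookup-left E))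
    ... | isRight = ≡.trans Dr≡l (≡.sym (lookup-right E))
    ... | old a   = ≡.trans (proj₂ (image a))
      (≡.trans (cong ι (≡.sym (Vec.lookup∘tabulate (proj₁ ∘ image) a))) (≡.sym (lookup-ι E a)))

  module _ {p q : ℕ} (p≤i : p ≤ i) (h≤q : h ≤ q) where

    wide-inside : ∀ a → Inside p q a → Inside p (2 ℕ.+ q) (ι a)
    wide-inside a (p≤a , a<q) with position a
    ... | before _ eq    rewrite eq = p≤a , ℕ.m≤n⇒m≤o+n 2 a<q
    ... | between _ _ eq rewrite eq = ℕ.m≤n⇒m≤1+n p≤a , s≤s (ℕ.m≤n⇒m≤1+n a<q)
    ... | after _ eq     rewrite eq = ℕ.m≤n⇒m≤o+n 2 p≤a , s≤s (s≤s a<q)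

    wide-inside⁻ : ∀ a → Inside p (2 ℕ.+ q) (ι a) → Inside p q a
    wide-inside⁻ a (p≤ιa , ιa<q) with position a
    ... | before a<i eq      rewrite eq = p≤ιa , ℕ.<-≤-trans a<i (ℕ.≤-trans i≤h h≤q)
    ... | between i≤a a<h eq rewrite eq = ℕ.≤-trans p≤i i≤a , ℕ.<-≤-trans a<h h≤q
    ... | after h≤a eq       rewrite eq = ℕ.≤-trans p≤i (ℕ.≤-trans i≤h h≤a) , s≤s⁻¹ (s≤s⁻¹ ιa<q)

    wide-left : Inside p (2 ℕ.+ q) left
    wide-left rewrite toℕ-left = p≤i , s≤s (ℕ.m≤n⇒m≤1+n (ℕ.≤-trans i≤h h≤q))

    wide-right : Inside p (2 ℕ.+ q) right
    wide-right rewrite toℕ-right = ℕ.m≤n⇒m≤1+n (ℕ.≤-trans p≤i i≤h) , s≤s (s≤s h≤q)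

    -- An interval that starts at or before i and reaches h takes in both new points, so only its
    -- right end moves, by two.
    wide-closed : ∀ {D} → Closed p q D → Closed p (2 ℕ.+ q) (insertChord D)
    wide-closed {D} c x in-x with point x
    ... | isLeft  rewrite lookup-left D  = wide-right
    ... | isRight rewrite lookup-right D = wide-left
    ... | old a   rewrite lookup-ι D a   = wide-inside _ (c a (wide-inside⁻ a in-x))

    wide-closed⁻ : ∀ {D} → Closed p (2 ℕ.+ q) (insertChord D) → Closed p q D
    wide-closed⁻ {D} c a in-a =
      wide-inside⁻ _ (subst (Inside p (2 ℕ.+ q)) (lookup-ι D a) (c (ι a) (wide-inside a in-a)))

  module _ {p q : ℕ} (h≤p : h ≤ p) where

    late-inside : ∀ a → Inside p q a → Inside (2 ℕ.+ p) (2 ℕ.+ q) (ι a)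
    late-inside a (p≤a , a<q) with position a
    ... | before a<i _    = contradiction (ℕ.<-≤-trans a<i (ℕ.≤-trans i≤h (ℕ.≤-trans h≤p p≤a))) (ℕ.<-irrefl ≡.refl)
    ... | between _ a<h _ = contradiction (ℕ.<-≤-trans a<h (ℕ.≤-trans h≤p p≤a)) (ℕ.<-irrefl ≡.refl)
    ... | after _ eq rewrite eq = s≤s (s≤s p≤a) , s≤s (s≤s a<q)

    late-inside⁻ : ∀ a → Inside (2 ℕ.+ p) (2 ℕ.+ q) (ι a) → Inside p q a
    late-inside⁻ a (p<ιa , ιa<q) with position a
    ... | before a<i eq    rewrite eq =
      contradiction (ℕ.<-≤-trans a<i (ℕ.≤-trans i≤h (ℕ.≤-trans h≤p (ℕ.≤-trans (ℕ.m≤n+m p 2) p<ιa)))) (ℕ.<-irrefl ≡.refl)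
    ... | between _ a<h eq rewrite eq =
      contradiction (ℕ.<-≤-trans a<h (ℕ.≤-trans h≤p (ℕ.≤-trans (ℕ.n≤1+n p) (s≤s⁻¹ p<ιa)))) (ℕ.<-irrefl ≡.refl)
    ... | after _ eq       rewrite eq = s≤s⁻¹ (s≤s⁻¹ p<ιa) , s≤s⁻¹ (s≤s⁻¹ ιa<q)

    late-left : ¬ Inside (2 ℕ.+ p) (2 ℕ.+ q) left
    late-left (p<l , _) rewrite toℕ-left =
      ℕ.<-irrefl ≡.refl (ℕ.≤-trans p<l (ℕ.m≤n⇒m≤1+n (ℕ.≤-trans i≤h h≤p)))

    late-right : ¬ Inside (2 ℕ.+ p) (2 ℕ.+ q) right
    late-right (p<r , _) rewrite toℕ-right = ℕ.<-irrefl ≡.refl (ℕ.≤-trans p<r (s≤s h≤p))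

    -- Past the new chord everything is merely shifted by two.
    late-closed : ∀ {D} → Closed p q D → Closed (2 ℕ.+ p) (2 ℕ.+ q) (insertChord D)
    late-closed {D} c x in-x with point x
    ... | isLeft  = contradiction in-x late-left
    ... | isRight = contradiction in-x late-right
    ... | old a   rewrite lookup-ι D a = late-inside _ (c a (late-inside⁻ a in-x))

    late-closed⁻ : ∀ {D} → Closed (2 ℕ.+ p) (2 ℕ.+ q) (insertChord D) → Closed p q D
    late-closed⁻ {D} c a in-a =
      late-inside⁻ _ (subst (Inside (2 ℕ.+ p) (2 ℕ.+ q)) (lookup-ι D a) (c (ι a) (late-inside a in-a)))

  insert-noClosed⁻ : ∀ {L D} → IsMatching D → Openers h D →
    NoClosed L (insertChord D) → NoClosed (closeStarts L h i) D
  insert-noClosed⁻ {L} {D} M O N p q Lp p<q q≤m c with p ℕ.<? h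
  -- The shifted interval starts at 2 + p, so it cannot be the whole diagram.
  ... | no p≮h = contradiction
    (proj₁ (N (2 ℕ.+ p) (2 ℕ.+ q) (≡.trans (≡.sym (closeStarts-≥ L i (ℕ.≮⇒≥ p≮h))) Lp)
              (s≤s (s≤s p<q)) (s≤s (s≤s q≤m)) (late-closed (ℕ.≮⇒≥ p≮h) c)))
    λ ()
  ... | yes p<h =
    let p<ᵇi , Lp≡true = ∧-true (≡.trans (≡.sym (closeStarts-< L i p<h)) Lp)
        p≡0 , q≡m = N p (2 ℕ.+ q) Lp≡true (ℕ.m≤n⇒m≤o+n 2 p<q) (s≤s (s≤s q≤m))
                      (wide-closed (s≤s⁻¹ (<ᵇ-true⁻ p<ᵇi)) h≤q c)
    in p≡0 , ℕ.suc-injective (ℕ.suc-injective q≡m)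
    where
    ∧-true : ∀ {b b′} → b ∧ b′ ≡ true → b ≡ true × b′ ≡ true
    ∧-true {true} eq = ≡.refl , eq
    p<m : p < m
    p<m = ℕ.<-≤-trans p<q q≤m
    a : Fin m
    a = fromℕ< p<m
    a≡p : toℕ a ≡ p
    a≡p = Fin.toℕ-fromℕ< p<m
    -- Point p opens a chord whose partner lies at h or later, and the interval contains this
    -- partner.
    h≤q : h ≤ q
    h≤q = ℕ.≤-trans (opener-≥ D M O a (subst (_< h) (≡.sym a≡p) p<h))
      (ℕ.<⇒≤ (proj₂ (c a (ℕ.≤-reflexive (≡.sym a≡p) , subst (_< q) (≡.sym a≡p) p<q))))

  insert-attached : ∀ {L D} → NoClosed L (insertChord D) → detached m h i L ≡ false
  insert-attached {L} {D} N with detached m h i L in eq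
  ... | false = ≡.refl
  ... | true  = contradiction (s≤s⁻¹ (s≤s⁻¹ (ℕ.≤-reflexive (≡.sym 2+h≡2+m)))) (ℕ.<⇒≱ (subst (_< m) (≡.sym h≡0) 0<m))
    where
    0<m : 0 < m
    0<m = proj₁ (detached-true⁻ {m} {h} {i} {L} eq)
    i≡h : i ≡ h
    i≡h = proj₁ (proj₂ (detached-true⁻ {m} {h} {i} {L} eq))
    Lh : L h ≡ true
    Lh = proj₂ (proj₂ (detached-true⁻ {m} {h} {i} {L} eq))
    -- Widened by the new chord, the empty interval at h becomes [h , h + 2), the new chord alone.
    empty : Closed h h D
    empty a (h≤a , a<h) = contradiction a<h (ℕ.≤⇒≯ h≤a)
    whole : h ≡ 0 × 2 ℕ.+ h ≡ 2 ℕ.+ m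
    whole = N h (2 ℕ.+ h) Lh (ℕ.m<n⇒m<1+n (ℕ.n<1+n h)) (s≤s (s≤s h≤m))
              (wide-closed (ℕ.≤-reflexive (≡.sym i≡h)) ℕ.≤-refl empty)
    h≡0 : h ≡ 0
    h≡0 = proj₁ whole
    2+h≡2+m : 2 ℕ.+ h ≡ 2 ℕ.+ m
    2+h≡2+m = proj₂ whole

  -- A closed interval of the larger diagram contains both new points or lies to their right, and
  -- mostly comes from one of `D`. Two exceptions remain: the new chord alone in [h , h + 2), and
  -- the rest of the diagram behind it when h = 0. If m is positive, `attached` excludes both.
  insert-noClosed : ∀ {L D} → L 0 ≡ true → IsMatching D → Openers h D → detached m h i L ≡ false →
    NoClosed (closeStarts L h i) D → NoClosed L (insertChord D)
  insert-noClosed {L} {D} L0 M O attached N p q Lp p<q q≤m c with p ℕ.≤? h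
  ... | yes p≤h = early q p<q q≤m c 2+h≤q
    where
    p<2+m : p < 2 ℕ.+ m
    p<2+m = ℕ.<-≤-trans p<q q≤m
    x : Fin (2 ℕ.+ m)
    x = fromℕ< p<2+m
    x≡p : toℕ x ≡ p
    x≡p = Fin.toℕ-fromℕ< p<2+m
    2+h≤q : 2 ℕ.+ h ≤ q
    2+h≤q = ℕ.≤-<-trans
      (opener-≥ (insertChord D) (insert-matching D M) (insert-openers D O) x (subst (_< suc h) (≡.sym x≡p) (s≤s p≤h)))
      (proj₂ (c x (ℕ.≤-reflexive (≡.sym x≡p) , subst (_< q) (≡.sym x≡p) p<q)))
    p≤i : p ≤ i
    p≤i = subst (p ≤_) toℕ-left (proj₁ (subst (Inside p q) (lookup-right D)
      (c right (subst (λ r → p ≤ r × r < q) (≡.sym toℕ-right) (ℕ.m≤n⇒m≤1+n p≤h , 2+h≤q)))))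
    early : ∀ q → p < q → q ≤ 2 ℕ.+ m → Closed p q (insertChord D) → 2 ℕ.+ h ≤ q → p ≡ 0 × q ≡ 2 ℕ.+ m
    early (suc (suc q)) p<q (s≤s (s≤s q≤m)) c (s≤s (s≤s h≤q)) with p ℕ.<? h
    ... | yes p<h =
      let p≡0 , q≡m = N p q (≡.trans (closeStarts-< L i p<h) (cong₂ _∧_ (<ᵇ-true (s≤s p≤i)) Lp))
                        (ℕ.<-≤-trans p<h h≤q) q≤m (wide-closed⁻ p≤i h≤q c)
      in p≡0 , cong (2 ℕ.+_) q≡m
    ... | no p≮h = ≡.trans p≡h h≡0 , cong (2 ℕ.+_) (ℕ.≤-antisym q≤m (subst (_≤ q) (≡.sym m≡0) z≤n))
      where
      p≡h : p ≡ h
      p≡h = ℕ.≤-antisym p≤h (ℕ.≮⇒≥ p≮h)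
      i≡h : i ≡ h
      i≡h = ℕ.≤-antisym i≤h (subst (_≤ i) p≡h p≤i)
      m≡0 : m ≡ 0
      m≡0 with m ℕ.≟ 0
      ... | yes eq  = eq
      ... | no  m≢0 = contradiction
        (≡.trans (≡.sym (detached-true {m} {h} {L} (ℕ.n≢0⇒n>0 m≢0) (subst (λ p → L p ≡ true) p≡h Lp)))
               (≡.trans (cong (λ i → detached m h i L) (≡.sym i≡h)) attached))
        λ ()
      h≡0 : h ≡ 0
      h≡0 = ℕ.n≤0⇒n≡0 (subst (h ≤_) m≡0 h≤m)
  ... | no p≰h = late p q Lp (ℕ.≰⇒> p≰h) p<q q≤m c
    where
    late : ∀ p q → L p ≡ true → h < p → p < q → q ≤ 2 ℕ.+ m → Closed p q (insertChord D) → p ≡ 0 × q ≡ 2 ℕ.+ m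
    late (suc p) q Lp (s≤s h≤p) p<q q≤m c with h ℕ.≟ p
    -- Starting at h + 1, the interval would contain `right` without `left`.
    ... | yes ≡.refl = contradiction
      (subst (suc p ≤_) toℕ-left (proj₁ (subst (Inside (suc p) q) (lookup-right D)
        (c right (ℕ.≤-reflexive (≡.sym toℕ-right) , subst (_< q) (≡.sym toℕ-right) p<q)))))
      (ℕ.≤⇒≯ i≤h)
    late (suc zero) q Lp (s≤s z≤n) p<q q≤m c | no h≢p = contradiction ≡.refl h≢p
    -- Here `N` forces p = 0, hence h = i = 0: the new chord is a block of its own before a nonempty
    -- rest.
    late (suc (suc p)) (suc (suc q)) Lp (s≤s h≤1+p) (s≤s (s≤s p<q)) (s≤s (s≤s q≤m)) c | no h≢1+p =
      contradiction (≡.trans (≡.sym (detached-true {m} {0} {L} 0<m L0)) (≡.trans (≡.sym detached≡) attached)) λ ()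
      where
      h≤p : h ≤ p
      h≤p = s≤s⁻¹ (ℕ.≤∧≢⇒< h≤1+p h≢1+p)
      whole : p ≡ 0 × q ≡ m
      whole = N p q (≡.trans (closeStarts-≥ L i h≤p) Lp) p<q q≤m (late-closed⁻ h≤p c)
      0<m : 0 < m
      0<m = ℕ.≤-<-trans z≤n (ℕ.<-≤-trans p<q q≤m)
      h≡0 : h ≡ 0
      h≡0 = ℕ.n≤0⇒n≡0 (subst (h ≤_) (proj₁ whole) h≤p)
      detached≡ : detached m h i L ≡ detached m 0 0 L
      detached≡ = cong₂ (λ h i → detached m h i L) h≡0 (ℕ.n≤0⇒n≡0 (subst (i ≤_) h≡0 i≤h))

-- Crossings and top chords

unique-↭ : ∀ {A : Set} {xs ys : List A} → Unique xs → Unique ys →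
           (∀ {x} → x ∈ xs → x ∈ ys) → (∀ {x} → x ∈ ys → x ∈ xs) → xs ↭ ys
unique-↭ xs! ys! xs⊆ys ys⊆xs = ∼bag⇒↭ (unique∧set⇒bag xs! ys! (mk⇔ xs⊆ys ys⊆xs))

module _ {A : Set} {P : A → Set} (P? : U.Decidable P) where

  count : List A → ℕ
  count xs = length (filter P? xs)

  count-++ : ∀ xs ys → count (xs ++ ys) ≡ count xs ℕ.+ count ys
  count-++ xs ys = ≡.trans (cong length (List.filter-++ P? xs ys)) (List.length-++ (filter P? xs))

  count-↭ : ∀ {xs ys} → xs ↭ ys → count xs ≡ count ys
  count-↭ xs↭ys = ↭-length (filter-↭ P? xs↭ys)

  count-∷ : ∀ x xs → count (x ∷ xs) ≡ count [ x ] ℕ.+ count xs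
  count-∷ x = count-++ [ x ]

count-map : ∀ {A B : Set} {P : B → Set} (P? : U.Decidable P) (f : A → B) xs →
            count P? (map f xs) ≡ count (P? ∘ f) xs
count-map P? f []       = ≡.refl
count-map P? f (x ∷ xs) with P? (f x)
... | yes _ = cong suc (count-map P? f xs)
... | no  _ = count-map P? f xs

count-cong : ∀ {A : Set} {P Q : A → Set} (P? : U.Decidable P) (Q? : U.Decidable Q) xs →
             (∀ {x} → x ∈ xs → P x ⇔ Q x) → count P? xs ≡ count Q? xs
count-cong P? Q? []       P⇔Q = ≡.refl
count-cong P? Q? (x ∷ xs) P⇔Q with P? x | Q? x
... | yes _ | yes _ = cong suc (count-cong P? Q? xs (P⇔Q ∘ there))
... | no  _ | no  _ = count-cong P? Q? xs (P⇔Q ∘ there)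
... | yes p | no ¬q = contradiction (Equivalence.to (P⇔Q (here ≡.refl)) p) ¬q
... | no ¬p | yes q = contradiction (Equivalence.from (P⇔Q (here ≡.refl)) q) ¬p

module _ {A : Set} {R : A → A → Set} (R? : Decidable R) where

  countPairs : List A → ℕ
  countPairs xs = count (λ (x , y) → R? x y) (unorderedPairs xs)

  countPairs-∷ : ∀ x xs → countPairs (x ∷ xs) ≡ count (R? x) xs ℕ.+ countPairs xs
  countPairs-∷ x xs = ≡.trans (count-++ _ (map (x ,_) xs) (unorderedPairs xs))
    (cong (ℕ._+ countPairs xs) (count-map _ (x ,_) xs))

  -- An inserted chord may land anywhere in the lexicographic list `chords`. Reordering can reverse
  -- a pair, which symmetry of the relation makes harmless.
  countPairs-↭ : Symmetric R → ∀ {xs ys} → xs ↭ ys → countPairs xs ≡ countPairs ys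
  countPairs-↭ R-sym ↭.refl = ≡.refl
  countPairs-↭ R-sym (↭.trans p q) = ≡.trans (countPairs-↭ R-sym p) (countPairs-↭ R-sym q)
  countPairs-↭ R-sym {x ∷ xs} {_ ∷ ys} (prep x p) = begin
    countPairs (x ∷ xs)            ≡⟨ countPairs-∷ x xs ⟩
    count (R? x) xs ℕ.+ countPairs xs ≡⟨ cong₂ ℕ._+_ (count-↭ (R? x) p) (countPairs-↭ R-sym p) ⟩
    count (R? x) ys ℕ.+ countPairs ys ≡⟨ countPairs-∷ x ys ⟨
    countPairs (x ∷ ys)            ∎
    where open ≡.≡-Reasoning
  countPairs-↭ R-sym {x ∷ y ∷ xs} {_ ∷ _ ∷ ys} (swap x y p) = begin
    countPairs (x ∷ y ∷ xs)
      ≡⟨ expand x y xs ⟩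
    (count (R? x) [ y ] ℕ.+ count (R? x) xs) ℕ.+ (count (R? y) xs ℕ.+ countPairs xs)
      ≡⟨ cong₂ ℕ._+_ (cong₂ ℕ._+_ symmetric (count-↭ (R? x) p)) (cong₂ ℕ._+_ (count-↭ (R? y) p) (countPairs-↭ R-sym p)) ⟩
    (count (R? y) [ x ] ℕ.+ count (R? x) ys) ℕ.+ (count (R? y) ys ℕ.+ countPairs ys)
      ≡⟨ solve 4 (λ a b c d → (a :+ b) :+ (c :+ d) := (a :+ c) :+ (b :+ d)) ≡.refl
           (count (R? y) [ x ]) (count (R? x) ys) (count (R? y) ys) (countPairs ys) ⟩
    (count (R? y) [ x ] ℕ.+ count (R? y) ys) ℕ.+ (count (R? x) ys ℕ.+ countPairs ys)
      ≡⟨ expand y x ys ⟨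
    countPairs (y ∷ x ∷ ys) ∎
    where
    open ≡.≡-Reasoning
    open import Data.Nat.Solver using (module +-*-Solver)
    open +-*-Solver
    expand : ∀ x y xs → countPairs (x ∷ y ∷ xs) ≡
             (count (R? x) [ y ] ℕ.+ count (R? x) xs) ℕ.+ (count (R? y) xs ℕ.+ countPairs xs)
    expand x y xs = ≡.trans (countPairs-∷ x (y ∷ xs)) (cong₂ ℕ._+_ (count-∷ (R? x) y xs) (countPairs-∷ y xs))
    symmetric : count (R? x) [ y ] ≡ count (R? y) [ x ]
    symmetric with R? x y | R? y x
    ... | yes _ | yes _ = ≡.refl
    ... | no _  | no _  = ≡.refl
    ... | yes r | no ¬r = contradiction (R-sym r) ¬r
    ... | no ¬r | yes r = contradiction (R-sym r) ¬r

countPairs-map : ∀ {A B : Set} {R : B → B → Set} {S : A → A → Set} (R? : Decidable R) (S? : Decidable S) (f : A → B) →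
  (∀ {x y} → R (f x) (f y) ⇔ S x y) → ∀ xs → countPairs R? (map f xs) ≡ countPairs S? xs
countPairs-map R? S? f R⇔S []       = ≡.refl
countPairs-map R? S? f R⇔S (x ∷ xs) = begin
  countPairs R? (f x ∷ map f xs)                         ≡⟨ countPairs-∷ R? (f x) (map f xs) ⟩
  count (R? (f x)) (map f xs) ℕ.+ countPairs R? (map f xs) ≡⟨ cong₂ ℕ._+_ (≡.trans (count-map (R? (f x)) f xs) (count-cong _ (S? x) xs (λ _ → R⇔S)))
                                                              (countPairs-map R? S? f R⇔S xs) ⟩
  count (S? x) xs ℕ.+ countPairs S? xs                     ≡⟨ countPairs-∷ S? x xs ⟨
  countPairs S? (x ∷ xs)                                 ∎
  where open ≡.≡-Reasoning

crosses-sym : ∀ {m} → Symmetric (Crosses {m})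
crosses-sym (inj₁ x) = inj₂ x
crosses-sym (inj₂ x) = inj₁ x

allPairs! : ∀ m → Unique (allPairs m)
allPairs! m = Unique.cartesianProduct⁺ (Unique.allFin⁺ m) (Unique.allFin⁺ m)

chords! : ∀ {m} (D : Table m) → Unique (chords D)
chords! D = Unique.filter⁺ (isChord? D) (allPairs! _)

∈-chords⁺ : ∀ {m} (D : Table m) {c} → IsChord D c → c ∈ chords D
∈-chords⁺ D {c} = ∈-filter⁺ (isChord? D) (∈-allPairs c)

∈-chords⁻ : ∀ {m} (D : Table m) {c} → c ∈ chords D → IsChord D c
∈-chords⁻ D = proj₂ ∘ ∈-filter⁻ (isChord? D) {xs = allPairs _}

topGain : ℕ → ℕ
topGain zero    = 1
topGain (suc _) = 0

module InsertionStatistics {m h i : ℕ} (i≤h : i ≤ h) (h≤m : h ≤ m)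
  (D : Table m) (M : IsMatching D) (O : Openers h D) where

  open Insertion i≤h h≤m

  ι² : Chord m → Chord (2 ℕ.+ m)
  ι² (a , b) = ι a , ι b

  ι²-injective : ∀ {c d} → ι² c ≡ ι² d → c ≡ d
  ι²-injective eq = cong₂ _,_ (ι-injective (cong proj₁ eq)) (ι-injective (cong proj₂ eq))

  isChord-ι : ∀ {c} → IsChord D c → IsChord (insertChord D) (ι² c)
  isChord-ι (a<b , Da≡b) = ι-mono-< a<b , ≡.trans (lookup-ι D _) (cong ι Da≡b)

  isChord-new : IsChord (insertChord D) (left , right)
  isChord-new = left<right , lookup-left D

  chords-insert : chords (insertChord D) ↭ (left , right) ∷ map ι² (chords D)
  chords-insert = unique-↭ (chords! (insertChord D)) (All.tabulate new≢old AllPairs.∷ Unique.map⁺ ι²-injective (chords! D)) to from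
    where
    new≢old : ∀ {c} → c ∈ map ι² (chords D) → (left , right) ≢ c
    new≢old c∈ eq with ∈-map⁻ ι² c∈
    ... | _ , _ , ≡.refl = ι≢left (≡.sym (cong proj₁ eq))
    to : ∀ {c} → c ∈ chords (insertChord D) → c ∈ (left , right) ∷ map ι² (chords D)
    to {x , y} c∈ with ∈-chords⁻ (insertChord D) c∈
    ... | x<y , Dx≡y with point x
    ...   | isLeft  = here (cong (left ,_) (≡.trans (≡.sym Dx≡y) (lookup-left D)))
    ...   | isRight = contradiction (subst (right Fin.<_) (≡.trans (≡.sym Dx≡y) (lookup-right D)) x<y) (ℕ.<⇒≯ left<right)
    ...   | old a   = there (subst (λ y → (ι a , y) ∈ map ι² (chords D)) (≡.sym y≡)
                        (∈-map⁺ ι² (∈-chords⁺ D (ι-cancel-< (subst (ι a Fin.<_) y≡ x<y) , ≡.refl))))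
      where
      y≡ : y ≡ ι (lookup D a)
      y≡ = ≡.trans (≡.sym Dx≡y) (lookup-ι D a)
    from : ∀ {c} → c ∈ (left , right) ∷ map ι² (chords D) → c ∈ chords (insertChord D)
    from (here ≡.refl) = ∈-chords⁺ (insertChord D) isChord-new
    from (there c∈) with ∈-map⁻ ι² c∈
    ... | c , c∈D , ≡.refl = ∈-chords⁺ (insertChord D) (isChord-ι (∈-chords⁻ D c∈D))

  ι<left : ∀ {a} → ι a Fin.< left ⇔ toℕ a < i
  ι<left {a} rewrite toℕ-left with position a
  ... | before a<i eq      rewrite eq = mk⇔ (λ p → p) (λ p → p)
  ... | between i≤a _ eq   rewrite eq = mk⇔ (ℕ.<-trans (ℕ.n<1+n _)) (λ p → contradiction p (ℕ.≤⇒≯ i≤a))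
  ... | after h≤a eq       rewrite eq = mk⇔ (ℕ.<-trans (ℕ.n<1+n _) ∘ ℕ.<-trans (ℕ.n<1+n _)) (λ p → contradiction p (ℕ.≤⇒≯ (ℕ.≤-trans i≤h h≤a)))

  ι<right : ∀ {a} → ι a Fin.< right ⇔ toℕ a < h
  ι<right {a} rewrite toℕ-right with position a
  ... | before a<i eq      rewrite eq = mk⇔ (λ _ → ℕ.<-≤-trans a<i i≤h) ℕ.m<n⇒m<1+n
  ... | between i≤a a<h eq rewrite eq = mk⇔ s≤s⁻¹ s≤s
  ... | after h≤a eq       rewrite eq = mk⇔ (ℕ.<-trans (ℕ.n<1+n _) ∘ s≤s⁻¹) (λ p → contradiction p (ℕ.≤⇒≯ h≤a))

  left<ι : ∀ {a} → left Fin.< ι a ⇔ i ≤ toℕ a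
  left<ι {a} = mk⇔ (λ l<ιa → ℕ.≮⇒≥ λ a<i → ℕ.<⇒≯ l<ιa (Equivalence.from ι<left a<i))
    (λ i≤a → ℕ.≤∧≢⇒< (ℕ.≮⇒≥ λ ιa<l → ℕ.<⇒≱ (Equivalence.to ι<left ιa<l) i≤a) (ι≢left ∘ ≡.sym ∘ Fin.toℕ-injective))

  right<ι : ∀ {a} → right Fin.< ι a ⇔ h ≤ toℕ a
  right<ι {a} = mk⇔ (λ r<ιa → ℕ.≮⇒≥ λ a<h → ℕ.<⇒≯ r<ιa (Equivalence.from ι<right a<h))
    (λ h≤a → ℕ.≤∧≢⇒< (ℕ.≮⇒≥ λ ιa<r → ℕ.<⇒≱ (Equivalence.to ι<right ιa<r) h≤a) (ι≢right ∘ ≡.sym ∘ Fin.toℕ-injective))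

  -- Either the chord starts among the first h points, which are not partners of each other, or it
  -- already starts at h or later. Hence the new chord is the first to close.
  closer-≥ : ∀ {a b} → IsChord D (a , b) → h ≤ toℕ b
  closer-≥ {a} {b} (a<b , Da≡b) with toℕ a ℕ.<? h
  ... | yes a<h = subst (λ b → h ≤ toℕ b) Da≡b (opener-≥ D M O a a<h)
  ... | no  a≮h = ℕ.≤-trans (ℕ.≮⇒≥ a≮h) (ℕ.<⇒≤ a<b)

  OpenedAfter : Chord m → Set
  OpenedAfter (a , _) = Inside i h a

  crosses-new : ∀ {c} → IsChord D c → Crosses (left , right) (ι² c) ⇔ OpenedAfter c
  crosses-new {a , b} c = mk⇔ to from
    where
    to : Crosses (left , right) (ι a , ι b) → Inside i h a
    to (inj₁ (l<a , a<r , _)) = Equivalence.to left<ι l<a , Equivalence.to ι<right a<r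
    to (inj₂ (_ , _ , b<r))   = contradiction (Equivalence.to ι<right b<r) (ℕ.≤⇒≯ (closer-≥ c))
    from : Inside i h a → Crosses (left , right) (ι a , ι b)
    from (i≤a , a<h) = inj₁ (Equivalence.from left<ι i≤a , Equivalence.from ι<right a<h , Equivalence.from right<ι (closer-≥ c))

  openedAfter? : U.Decidable OpenedAfter
  openedAfter? (a , _) = inside? i h a

  -- All points from i to h - 1 are openers, so each carries exactly one such chord.
  count-openedAfter : count openedAfter? (chords D) ≡ h ∸ i
  count-openedAfter = ≡.trans
    (↭-length (unique-↭ (Unique.filter⁺ openedAfter? (chords! D)) (Unique.tabulate⁺ chordAt-injective) to from))
    (List.length-tabulate chordAt)
    where
    at<h : ∀ (t : Fin (h ∸ i)) → i ℕ.+ toℕ t < h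
    at<h t = subst (i ℕ.+ toℕ t <_) (ℕ.m+[n∸m]≡n i≤h) (ℕ.+-monoʳ-< i (Fin.toℕ<n t))
    at : Fin (h ∸ i) → Fin m
    at t = fromℕ< (ℕ.<-≤-trans (at<h t) h≤m)
    toℕ-at : ∀ t → toℕ (at t) ≡ i ℕ.+ toℕ t
    toℕ-at t = Fin.toℕ-fromℕ< (ℕ.<-≤-trans (at<h t) h≤m)
    chordAt : Fin (h ∸ i) → Chord m
    chordAt t = at t , lookup D (at t)
    chordAt-injective : ∀ {s t} → chordAt s ≡ chordAt t → s ≡ t
    chordAt-injective {s} {t} eq = Fin.toℕ-injective (ℕ.+-cancelˡ-≡ i _ _
      (≡.trans (≡.sym (toℕ-at s)) (≡.trans (cong (toℕ ∘ proj₁) eq) (toℕ-at t))))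
    to : ∀ {c} → c ∈ filter openedAfter? (chords D) → c ∈ List.tabulate chordAt
    to {a , b} c∈ with ∈-filter⁻ openedAfter? {xs = chords D} c∈
    ... | c∈D , (i≤a , a<h) with ∈-chords⁻ D c∈D
    ...   | _ , ≡.refl = subst (_∈ List.tabulate chordAt) (cong (λ a → a , lookup D a) at≡a) (∈-tabulate⁺ {f = chordAt} t)
      where
      t<h∸i : toℕ a ∸ i < h ∸ i
      t<h∸i = ℕ.∸-monoˡ-< a<h i≤a
      t : Fin (h ∸ i)
      t = fromℕ< t<h∸i
      at≡a : at t ≡ a
      at≡a = Fin.toℕ-injective (≡.trans (toℕ-at t)
        (≡.trans (cong (i ℕ.+_) (Fin.toℕ-fromℕ< t<h∸i)) (ℕ.m+[n∸m]≡n i≤a)))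
    from : ∀ {c} → c ∈ List.tabulate chordAt → c ∈ filter openedAfter? (chords D)
    from c∈ with ∈-tabulate⁻ {f = chordAt} c∈
    ... | t , ≡.refl = ∈-filter⁺ openedAfter? (∈-chords⁺ D (O (at t) at-t<h , ≡.refl)) (i≤at-t , at-t<h)
      where
      at-t<h : toℕ (at t) < h
      at-t<h = subst (_< h) (≡.sym (toℕ-at t)) (at<h t)
      i≤at-t : i ≤ toℕ (at t)
      i≤at-t = subst (i ≤_) (≡.sym (toℕ-at t)) (ℕ.m≤m+n i (toℕ t))

  crosses-ι : ∀ {c d} → Crosses (ι² c) (ι² d) ⇔ Crosses c d
  crosses-ι = mk⇔ to from
    where
    to : ∀ {c d} → Crosses (ι² c) (ι² d) → Crosses c d
    to (inj₁ (p , q , r)) = inj₁ (ι-cancel-< p , ι-cancel-< q , ι-cancel-< r)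
    to (inj₂ (p , q , r)) = inj₂ (ι-cancel-< p , ι-cancel-< q , ι-cancel-< r)
    from : ∀ {c d} → Crosses c d → Crosses (ι² c) (ι² d)
    from (inj₁ (p , q , r)) = inj₁ (ι-mono-< p , ι-mono-< q , ι-mono-< r)
    from (inj₂ (p , q , r)) = inj₂ (ι-mono-< p , ι-mono-< q , ι-mono-< r)

  cr-insert : cr (insertChord D) ≡ (h ∸ i) ℕ.+ cr D
  cr-insert = begin
    countPairs crosses? (chords (insertChord D))
      ≡⟨ countPairs-↭ crosses? crosses-sym chords-insert ⟩
    countPairs crosses? ((left , right) ∷ map ι² (chords D))
      ≡⟨ countPairs-∷ crosses? (left , right) (map ι² (chords D)) ⟩
    count (crosses? (left , right)) (map ι² (chords D)) ℕ.+ countPairs crosses? (map ι² (chords D))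
      ≡⟨ cong₂ ℕ._+_ (count-map (crosses? (left , right)) ι² (chords D))
                   (countPairs-map crosses? crosses? ι² (λ {c} {d} → crosses-ι {c} {d}) (chords D)) ⟩
    count (crosses? (left , right) ∘ ι²) (chords D) ℕ.+ cr D
      ≡⟨ cong (ℕ._+ cr D) (count-cong _ openedAfter? (chords D) (crosses-new ∘ ∈-chords⁻ D)) ⟩
    count openedAfter? (chords D) ℕ.+ cr D
      ≡⟨ cong (ℕ._+ cr D) count-openedAfter ⟩
    (h ∸ i) ℕ.+ cr D ∎
    where open ≡.≡-Reasoning

  -- The new chord ends before every old one, so it covers none of them.
  isTop-ι : ∀ {c} → IsChord D c → IsTop (insertChord D) (ι² c) ⇔ IsTop D c
  isTop-ι {a , b} ab = mk⇔ to from
    where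
    to : IsTop (insertChord D) (ι a , ι b) → IsTop D (a , b)
    to t = All.tabulate λ d∈ (p , q , r) →
      All.lookup t (∈-chords⁺ (insertChord D) (isChord-ι (∈-chords⁻ D d∈))) (ι-mono-< p , ι-mono-< q , ι-mono-< r)
    from : IsTop D (a , b) → IsTop (insertChord D) (ι a , ι b)
    from t = All.tabulate λ d∈ below-d → no-cover below-d (∈-resp-↭ chords-insert d∈)
      where
      no-cover : ∀ {d} → Below (ι a , ι b) d → ¬ d ∈ (left , right) ∷ map ι² (chords D)
      no-cover (_ , _ , b<r) (here ≡.refl) = ℕ.<⇒≱ (Equivalence.to ι<right b<r) (closer-≥ ab)
      no-cover (p , q , r) (there d∈) with ∈-map⁻ ι² d∈
      ... | d , d∈D , ≡.refl = All.lookup t d∈D (ι-cancel-< p , ι-cancel-< q , ι-cancel-< r)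

  top-new : i ≡ 0 → IsTop (insertChord D) (left , right)
  top-new i≡0 = All.tabulate λ { _ (c<l , _) → ℕ.n≮0 (subst (_ <_) (≡.trans toℕ-left i≡0) c<l) }

  -- The chord of point 0 covers the new one.
  ¬top-new : 0 < i → ¬ IsTop (insertChord D) (left , right)
  ¬top-new 0<i t = All.lookup t
    (∈-chords⁺ (insertChord D) (isChord-ι (O a a<h , ≡.refl)))
    (Equivalence.from ι<left a<i , left<right , Equivalence.from right<ι (opener-≥ D M O a a<h))
    where
    0<m : 0 < m
    0<m = ℕ.<-≤-trans 0<i (ℕ.≤-trans i≤h h≤m)
    a : Fin m
    a = fromℕ< 0<m
    a<i : toℕ a < i
    a<i = subst (_< i) (≡.sym (Fin.toℕ-fromℕ< 0<m)) 0<i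
    a<h : toℕ a < h
    a<h = ℕ.<-≤-trans a<i i≤h

  count-new-top : count (isTop? (insertChord D)) [ left , right ] ≡ topGain i
  count-new-top with isTop? (insertChord D) (left , right)
  ... | yes t = ≡.sym (cong topGain (ℕ.n≤0⇒n≡0 (ℕ.≮⇒≥ λ 0<i → ¬top-new 0<i t)))
  ... | no ¬t = ≡.sym (gain-pos (ℕ.n≢0⇒n>0 (¬t ∘ top-new)))
    where
    gain-pos : ∀ {i} → 0 < i → topGain i ≡ 0
    gain-pos (s≤s _) = ≡.refl

  top-insert : top (insertChord D) ≡ topGain i ℕ.+ top D
  top-insert = begin
    count isTop (chords (insertChord D))
      ≡⟨ count-↭ isTop chords-insert ⟩
    count isTop ((left , right) ∷ map ι² (chords D))
      ≡⟨ count-∷ isTop (left , right) (map ι² (chords D)) ⟩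
    count isTop [ left , right ] ℕ.+ count isTop (map ι² (chords D))
      ≡⟨ cong₂ ℕ._+_ count-new-top (count-map isTop ι² (chords D)) ⟩
    topGain i ℕ.+ count (isTop ∘ ι²) (chords D)
      ≡⟨ cong (topGain i ℕ.+_) (count-cong _ (isTop? D) (chords D) (isTop-ι ∘ ∈-chords⁻ D)) ⟩
    topGain i ℕ.+ top D ∎
    where
    open ≡.≡-Reasoning
    isTop : U.Decidable (IsTop (insertChord D))
    isTop = isTop? (insertChord D)

-- Enumeration by histories

vectors! : ∀ {A : Set} {xs : List A} → Unique xs → ∀ n → Unique (vectors xs n)
vectors! xs! zero    = All.[] AllPairs.∷ AllPairs.[]
vectors! xs! (suc n) = Unique.cartesianProductWith⁺ Vec._∷_ Vec.∷-injective xs! (vectors! xs! n)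

tables! : ∀ m → Unique (tables m)
tables! m = vectors! (Unique.allFin⁺ m) m

opaque

  family : ∀ m → ℕ → (ℕ → Bool) → List (Table m)
  family m h L = filter (admissible? h L) (tables m)

  family! : ∀ m h L → Unique (family m h L)
  family! m h L = Unique.filter⁺ (admissible? h L) (tables! m)

  ∈-family⁺ : ∀ {m h L} {D : Table m} → Admissible h L D → D ∈ family m h L
  ∈-family⁺ {h = h} {L} {D} = ∈-filter⁺ (admissible? h L) (∈-tables D)

  ∈-family⁻ : ∀ {m h L} {D : Table m} → D ∈ family m h L → Admissible h L D
  ∈-family⁻ {m} {h} {L} = proj₂ ∘ ∈-filter⁻ (admissible? h L) {xs = tables m}

-- The partner of point 0 can only lie to its right, so every nonempty matching has height 1 after
-- its first point.
∈-family-1 : ∀ {m L} {D : Table m} → IsMatching D → NoClosed L D → D ∈ family m 1 L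
∈-family-1 {D = D} M N = ∈-family⁺ (M , O , N)
  where
  O : Openers 1 D
  O zero (s≤s z≤n) = ℕ.n≢0⇒n>0 (proj₂ (M zero) ∘ Fin.toℕ-injective)

module _ {m h : ℕ} (h≤m : h ≤ m) (L : ℕ → Bool) where

  index≤h : ∀ (i : Fin (suc h)) → toℕ i ≤ h
  index≤h i = s≤s⁻¹ (Fin.toℕ<n i)

  module At (i : Fin (suc h)) = Insertion (index≤h i) h≤m

  closingPoint : Fin (2 ℕ.+ m)
  closingPoint = fromℕ< (s≤s (s≤s h≤m))

  branch : Fin (suc h) → List (Table (2 ℕ.+ m))
  branch i = if detached m h (toℕ i) L then []
             else map (At.insertChord i) (family m h (closeStarts L h (toℕ i)))

  ∈-branch⁺ : ∀ {i E} → detached m h (toℕ i) L ≡ false → Admissible h (closeStarts L h (toℕ i)) E →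
              At.insertChord i E ∈ branch i
  ∈-branch⁺ {i} attached adm rewrite attached = ∈-map⁺ (At.insertChord i) (∈-family⁺ adm)

  ∈-branch⁻ : ∀ {i D} → D ∈ branch i → ∃ λ E →
    Admissible h (closeStarts L h (toℕ i)) E × D ≡ At.insertChord i E × detached m h (toℕ i) L ≡ false
  ∈-branch⁻ {i} D∈ with detached m h (toℕ i) L
  ... | false = let E , E∈ , D≡ = ∈-map⁻ (At.insertChord i) D∈ in E , ∈-family⁻ E∈ , D≡ , ≡.refl

  branch! : ∀ i → Unique (branch i)
  branch! i with detached m h (toℕ i) L
  ... | true  = AllPairs.[]
  ... | false = Unique.map⁺ (At.insertChord-injective i) (family! m h _)

  branch-partner : ∀ {i D} → D ∈ branch i → toℕ (lookup D closingPoint) ≡ toℕ i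
  branch-partner {i} D∈ with ∈-branch⁻ {i} D∈
  ... | E , _ , ≡.refl , _ = ≡.trans (cong toℕ (At.lookup-right i E)) (At.toℕ-left i)

  toℕ-closingPoint : toℕ closingPoint ≡ suc h
  toℕ-closingPoint = Fin.toℕ-fromℕ< (s≤s (s≤s h≤m))

  -- Point h + 1 opens a chord or closes one of the h + 1 open ones. In the second case its partner
  -- determines the branch, and deleting that chord inverts the insertion.
  family-split : L 0 ≡ true →
    family (2 ℕ.+ m) (suc h) L ↭ family (2 ℕ.+ m) (2 ℕ.+ h) L ++ concat (List.tabulate branch)
  family-split L0 = unique-↭ (family! _ _ _)
    (Unique.++⁺ (family! _ _ _)
      (Unique.concat⁺ (All.tabulate⁺ branch!) (AllPairs.tabulate⁺ branches-disjoint)) open-close-disjoint)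
    to from
    where
    branches-disjoint : ∀ {i j} → i ≢ j → Disjoint (branch i) (branch j)
    branches-disjoint {i} {j} i≢j (D∈i , D∈j) =
      i≢j (Fin.toℕ-injective (≡.trans (≡.sym (branch-partner {i} D∈i)) (branch-partner {j} D∈j)))

    in-branch : ∀ {D} → D ∈ concat (List.tabulate branch) → ∃ λ i → D ∈ branch i
    in-branch D∈ with ∈-concat⁻′ (List.tabulate branch) D∈
    ... | _ , D∈Ds , Ds∈ with ∈-tabulate⁻ {f = branch} Ds∈
    ...   | i , ≡.refl = i , D∈Ds

    open-close-disjoint : Disjoint (family (2 ℕ.+ m) (2 ℕ.+ h) L) (concat (List.tabulate branch))
    open-close-disjoint (D∈o , D∈c) with in-branch D∈c
    ... | i , D∈i =
      ℕ.<-asym (proj₁ (proj₂ (∈-family⁻ D∈o)) closingPoint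
                   (subst (_< 2 ℕ.+ h) (≡.sym toℕ-closingPoint) ℕ.≤-refl))
                (subst (_< toℕ closingPoint) (≡.sym (branch-partner {i} D∈i))
                   (subst (toℕ i <_) (≡.sym toℕ-closingPoint) (Fin.toℕ<n i)))

    to : ∀ {D} → D ∈ family (2 ℕ.+ m) (suc h) L → D ∈ family (2 ℕ.+ m) (2 ℕ.+ h) L ++ concat (List.tabulate branch)
    to {D} D∈ with ∈-family⁻ D∈
    ... | M , O , N with closingPoint Fin.<? lookup D closingPoint
    ...   | yes opens = ∈-++⁺ˡ (∈-family⁺ (M , O⁺ , N))
      where
      O⁺ : Openers (2 ℕ.+ h) D
      O⁺ a a<2+h with toℕ a ℕ.<? suc h
      ... | yes a<1+h = O a a<1+h
      ... | no  a≮1+h = subst (λ a → a Fin.< lookup D a)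
        (Fin.toℕ-injective (≡.trans toℕ-closingPoint (ℕ.≤-antisym (ℕ.≮⇒≥ a≮1+h) (s≤s⁻¹ a<2+h)))) opens
    ...   | no ¬opens = ∈-++⁺ʳ (family (2 ℕ.+ m) (2 ℕ.+ h) L)
      (∈-concat⁺′ D∈branch (∈-tabulate⁺ {f = branch} i))
      where
      partner<1+h : toℕ (lookup D closingPoint) < suc h
      partner<1+h = subst (toℕ (lookup D closingPoint) <_) toℕ-closingPoint
        (ℕ.≤∧≢⇒< (ℕ.≮⇒≥ ¬opens) (proj₂ (M closingPoint) ∘ Fin.toℕ-injective))
      i : Fin (suc h)
      i = fromℕ< partner<1+h
      removed : ∃ λ E → D ≡ At.insertChord i E
      removed = At.removeChord i M
        (Fin.toℕ-injective (≡.sym (≡.trans (At.toℕ-left i) (Fin.toℕ-fromℕ< partner<1+h))))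
      E : Table m
      E = proj₁ removed
      D≡ : D ≡ At.insertChord i E
      D≡ = proj₂ removed
      ME : IsMatching E
      ME = At.insert-matching⁻ i E (subst IsMatching D≡ M)
      OE : Openers h E
      OE = At.insert-openers⁻ i E (subst (Openers (suc h)) D≡ O)
      ND : NoClosed L (At.insertChord i E)
      ND = subst (NoClosed L) D≡ N
      D∈branch : D ∈ branch i
      D∈branch = subst (_∈ branch i) (≡.sym D≡)
        (∈-branch⁺ {i} (At.insert-attached i {D = E} ND) (ME , OE , At.insert-noClosed⁻ i ME OE ND))

    from : ∀ {D} → D ∈ family (2 ℕ.+ m) (2 ℕ.+ h) L ++ concat (List.tabulate branch) → D ∈ family (2 ℕ.+ m) (suc h) L
    from {D} D∈ with ∈-++⁻ (family (2 ℕ.+ m) (2 ℕ.+ h) L) D∈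
    ... | inj₁ D∈o = let M , O , N = ∈-family⁻ D∈o in
      ∈-family⁺ (M , (λ a a<1+h → O a (ℕ.m<n⇒m<1+n a<1+h)) , N)
    ... | inj₂ D∈c with in-branch D∈c
    ...   | i , D∈i with ∈-branch⁻ {i} D∈i
    ...     | E , (M , O , N) , ≡.refl , attached =
      ∈-family⁺ (At.insert-matching i E M , At.insert-openers i E O , At.insert-noClosed i L0 M O attached N)

-- The first h points inject, through their partners, into the m ∸ h points beyond them.
overfull : ∀ {m h} (D : Table m) → h ≤ m → m ∸ h < h → IsMatching D → ¬ Openers h D
overfull {m} {h} D h≤m m∸h<h M O =
  let a , b , a<b , eq = Fin.pigeonhole m∸h<h closer in
  ℕ.<-irrefl (≡.trans (≡.sym (toℕ-at a)) (≡.trans (cong toℕ (lookup-injective (closer-eq a b eq))) (toℕ-at b))) a<b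
  where
  at : Fin h → Fin m
  at a = Fin.inject≤ a h≤m
  toℕ-at : ∀ a → toℕ (at a) ≡ toℕ a
  toℕ-at a = Fin.toℕ-inject≤ a h≤m
  h≤Da : ∀ a → h ≤ toℕ (lookup D (at a))
  h≤Da a = opener-≥ D M O (at a) (subst (_< h) (≡.sym (toℕ-at a)) (Fin.toℕ<n a))
  closer< : ∀ a → toℕ (lookup D (at a)) ∸ h < m ∸ h
  closer< a = ℕ.∸-monoˡ-< (Fin.toℕ<n (lookup D (at a))) (h≤Da a)
  closer : Fin h → Fin (m ∸ h)
  closer a = fromℕ< (closer< a)
  closer-eq : ∀ a b → closer a ≡ closer b → lookup D (at a) ≡ lookup D (at b)
  closer-eq a b eq = Fin.toℕ-injective (ℕ.∸-cancelʳ-≡ (h≤Da a) (h≤Da b)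
    (≡.trans (≡.sym (Fin.toℕ-fromℕ< (closer< a))) (≡.trans (cong toℕ eq) (Fin.toℕ-fromℕ< (closer< b)))))
  lookup-injective : ∀ {a b} → lookup D a ≡ lookup D b → a ≡ b
  lookup-injective {a} {b} eq = ≡.trans (≡.sym (proj₁ (M a))) (≡.trans (cong (lookup D) eq) (proj₁ (M b)))

-- Two points for each of the h open chords and the k chords still to be opened.
points : ℕ → ℕ → ℕ
points k h = (k ℕ.+ h) ℕ.+ (k ℕ.+ h)

points-close : ∀ k h → points k (suc h) ≡ 2 ℕ.+ points k h
points-close k h rewrite ℕ.+-suc k h | ℕ.+-suc (k ℕ.+ h) (k ℕ.+ h) = ≡.refl

points-open : ∀ k h → points (suc k) h ≡ points k (suc h)
points-open k h rewrite ℕ.+-suc k h = ≡.refl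

h≤points : ∀ k h → h ≤ points k h
h≤points k h = ℕ.≤-trans (ℕ.m≤n+m h k) (ℕ.m≤m+n (k ℕ.+ h) (k ℕ.+ h))

family-0 : ∀ L → family 0 0 L ↭ [ Vec.[] ]
family-0 L = unique-↭ (family! 0 0 L) (All.[] AllPairs.∷ AllPairs.[]) to from
  where
  to : ∀ {D} → D ∈ family 0 0 L → D ∈ [ Vec.[] ]
  to {Vec.[]} _ = here ≡.refl
  from : ∀ {D} → D ∈ [ Vec.[] ] → D ∈ family 0 0 L
  from (here ≡.refl) = ∈-family⁺ ((λ ()) , (λ ()) , λ p q _ p<q q≤0 _ → contradiction (ℕ.<-≤-trans p<q q≤0) ℕ.n≮0)

family-overfull : ∀ h L → family (2 ℕ.+ points 0 h) (2 ℕ.+ h) L ↭ []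
family-overfull h L = unique-↭ (family! _ _ _) AllPairs.[] to λ ()
  where
  m∸h<h : (2 ℕ.+ points 0 h) ∸ (2 ℕ.+ h) < 2 ℕ.+ h
  m∸h<h rewrite ℕ.m+n∸n≡m h h = s≤s (ℕ.n≤1+n h)
  to : ∀ {D} → D ∈ family (2 ℕ.+ points 0 h) (2 ℕ.+ h) L → D ∈ []
  to {D} D∈ = let M , O , _ = ∈-family⁻ D∈ in
    contradiction O (overfull D (s≤s (s≤s (h≤points 0 h))) m∸h<h M)

module Enumeration (R : CommutativeSemiring 0ℓ 0ℓ) (v x : CommutativeSemiring.Carrier R) where

  open CommutativeSemiring R hiding (zero)
  open import Algebra.Properties.CommutativeSemigroup +-commutativeSemigroup using () renaming (x∙yz≈y∙xz to +-swap)
  open import Algebra.Properties.CommutativeSemigroup *-commutativeSemigroup using () renaming (interchange to *-interchange)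
  open import Algebra.Properties.Semiring.Exp semiring using (_^_; ^-homo-*)
  open import Algebra.Properties.Semiring.Sum semiring using (sum; sum-cong-≋)
  open import Relation.Binary.Reasoning.Setoid setoid
  open Paths R v
  open Weights R v x

  total-↭ : ∀ {m} {Ds Es : List (Table m)} → Ds ↭ Es → total Ds ≈ total Es
  total-↭ ↭.refl              = refl
  total-↭ (↭.prep D p)        = +-congˡ (total-↭ p)
  total-↭ (↭.swap D E p)      =
    trans (+-congˡ (+-congˡ (total-↭ p))) (+-swap _ _ _)
  total-↭ (↭.trans p q)       = trans (total-↭ p) (total-↭ q)

  total-++ : ∀ {m} (Ds Es : List (Table m)) → total (Ds ++ Es) ≈ total Ds + total Es
  total-++ []       Es = sym (+-identityˡ _)
  total-++ (D ∷ Ds) Es = trans (+-congˡ (total-++ Ds Es)) (sym (+-assoc _ _ _))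

  total-concat : ∀ {m n} (f : Fin n → List (Table m)) → total (concat (List.tabulate f)) ≈ sum (λ i → total (f i))
  total-concat {n = zero}  f = refl
  total-concat {n = suc n} f =
    trans (total-++ (f zero) _) (+-congˡ (total-concat (f ∘ suc)))

  factor≈ : ∀ h i → factor x h i ≈ (x ^ topGain i) * (v ^ (h ∸ i))
  factor≈ h zero    = *-congʳ (sym (*-identityʳ x))
  factor≈ h (suc i) = sym (*-identityˡ _)

  module _ {m h i : ℕ} (i≤h : i ≤ h) (h≤m : h ≤ m) where

    open Insertion i≤h h≤m

    weight-insert : ∀ {D} → IsMatching D → Openers h D →
      (x ^ top (insertChord D)) * (v ^ cr (insertChord D)) ≈ factor x h i * ((x ^ top D) * (v ^ cr D))
    weight-insert {D} M O = begin
      (x ^ top (insertChord D)) * (v ^ cr (insertChord D))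
        ≡⟨ cong₂ (λ s t → (x ^ s) * (v ^ t)) top-insert cr-insert ⟩
      (x ^ (topGain i ℕ.+ top D)) * (v ^ (h ∸ i ℕ.+ cr D))
        ≈⟨ *-cong (^-homo-* x (topGain i) (top D)) (^-homo-* v (h ∸ i) (cr D)) ⟩
      ((x ^ topGain i) * (x ^ top D)) * ((v ^ (h ∸ i)) * (v ^ cr D))
        ≈⟨ *-interchange _ _ _ _ ⟩
      ((x ^ topGain i) * (v ^ (h ∸ i))) * ((x ^ top D) * (v ^ cr D))
        ≈⟨ *-congʳ (factor≈ h i) ⟨
      factor x h i * ((x ^ top D) * (v ^ cr D)) ∎
      where open InsertionStatistics i≤h h≤m D M O

    total-insert : ∀ Ds → (∀ {D} → D ∈ Ds → IsMatching D × Openers h D) →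
      total (map insertChord Ds) ≈ factor x h i * total Ds
    total-insert []       adm = sym (zeroʳ _)
    total-insert (D ∷ Ds) adm = trans
      (+-cong (let M , O = adm (here ≡.refl) in weight-insert M O) (total-insert Ds (adm ∘ there)))
      (sym (distribˡ _ _ _))

  familySum : ∀ m → ℕ → (ℕ → Bool) → Carrier
  familySum m h L = total (family m h L)

  familySum-split : ∀ {m h} → h ≤ m → ∀ L → L 0 ≡ true →
    familySum (2 ℕ.+ m) (suc h) L ≈
    familySum (2 ℕ.+ m) (2 ℕ.+ h) L +
    sum {suc h} (λ i → if detached m h (toℕ i) L then 0#
                       else factor x h (toℕ i) * familySum m h (closeStarts L h (toℕ i)))
  familySum-split {m} {h} h≤m L L0 = begin
    familySum (2 ℕ.+ m) (suc h) L
      ≈⟨ total-↭ (family-split h≤m L L0) ⟩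
    total (family (2 ℕ.+ m) (2 ℕ.+ h) L ++ concat (List.tabulate (branch h≤m L)))
      ≈⟨ total-++ (family (2 ℕ.+ m) (2 ℕ.+ h) L) _ ⟩
    familySum (2 ℕ.+ m) (2 ℕ.+ h) L + total (concat (List.tabulate (branch h≤m L)))
      ≈⟨ +-congˡ (trans (total-concat (branch h≤m L)) (sum-cong-≋ total-branch)) ⟩
    _ ∎
    where
    total-branch : ∀ i → total (branch h≤m L i) ≈
      (if detached m h (toℕ i) L then 0# else factor x h (toℕ i) * familySum m h (closeStarts L h (toℕ i)))
    total-branch i with detached m h (toℕ i) L
    ... | true  = refl
    ... | false = total-insert (index≤h h≤m L i) h≤m _ λ D∈ → let M , O , _ = ∈-family⁻ D∈ in M , O

  -- The condition on `L 0` survives each closing that leaves a chord open, and it makes an early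
  -- return to height 0 a forbidden interval.
  familySum≈pathSum : ∀ k h L → L 0 ≡ true → familySum (points k (suc h)) (suc h) L ≈ pathSum x k (suc h) L
  opening≈ : ∀ k h L → L 0 ≡ true →
    familySum (2 ℕ.+ points k h) (2 ℕ.+ h) L ≈ shift (λ k → pathSum x k (2 ℕ.+ h) L) k
  closing≈ : ∀ k h L → L 0 ≡ true → ∀ (i : Fin (suc h)) →
    (if detached (points k h) h (toℕ i) L then 0#
     else factor x h (toℕ i) * familySum (points k h) h (closeStarts L h (toℕ i))) ≈ closing x k h L i

  familySum≈pathSum k h L L0 = begin
    familySum (points k (suc h)) (suc h) L
      ≡⟨ cong (λ m → familySum m (suc h) L) (points-close k h) ⟩
    familySum (2 ℕ.+ points k h) (suc h) L
      ≈⟨ familySum-split (h≤points k h) L L0 ⟩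
    _
      ≈⟨ +-cong (opening≈ k h L L0) (sum-cong-≋ (closing≈ k h L L0)) ⟩
    shift (λ k → pathSum x k (2 ℕ.+ h) L) k + sum (closing x k h L)
      ≈⟨ pathSum-suc x k h L ⟨
    pathSum x k (suc h) L ∎

  opening≈ zero    h L L0 = total-↭ (family-overfull h L)
  opening≈ (suc k) h L L0 = begin
    familySum (2 ℕ.+ points (suc k) h) (2 ℕ.+ h) L
      ≡⟨ cong (λ m → familySum m (2 ℕ.+ h) L) (≡.trans (≡.sym (points-close (suc k) h)) (points-open k (suc h))) ⟩
    familySum (points k (2 ℕ.+ h)) (2 ℕ.+ h) L
      ≈⟨ familySum≈pathSum k (suc h) L L0 ⟩
    pathSum x k (2 ℕ.+ h) L ∎

  closing≈ zero zero L L0 zero = *-congˡ (trans (total-↭ (family-0 (closeStarts L 0 0)))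
    (trans (+-identityʳ _) (*-identityˡ 1#)))
  -- A first block is split off before the end: on the left `detached` empties the branch, on the
  -- right `pathSum` vanishes at height 0.
  closing≈ (suc k) zero L L0 zero rewrite L0 = sym (zeroʳ _)
  closing≈ k (suc h) L L0 i = if-cong detached≡detaches (*-congˡ (familySum≈pathSum k h (closeStarts L (suc h) (toℕ i)) L0))
    where
    detached≡detaches : detached (points k (suc h)) (suc h) (toℕ i) L ≡ detaches (suc h) (toℕ i) L
    detached≡detaches rewrite points-close k h = ≡.refl

  total≈pathSum : ∀ {Q : ∀ {m} → Table m → Set} (Q? : ∀ {m} → U.Decidable (Q {m})) {L} → L 0 ≡ true →
    (∀ {m} (D : Table m) → IsMatching D → Q D ⇔ NoClosed L D) →
    ∀ n → total (filter Q? (diagrams (suc n))) ≈ pathSum x n 1 L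
  total≈pathSum {Q} Q? {L} L0 Q⇔N n = begin
    total (filter Q? (diagrams (suc n)))
      ≈⟨ total-↭ (unique-↭ (Unique.filter⁺ Q? (Unique.filter⁺ isMatching? (tables! (2 ℕ.* suc n)))) (family! _ _ _) to from) ⟩
    familySum (2 ℕ.* suc n) 1 L
      ≡⟨ cong (λ m → familySum m 1 L) points≡ ⟩
    familySum (points n 1) 1 L
      ≈⟨ familySum≈pathSum n 0 L L0 ⟩
    pathSum x n 1 L ∎
    where
    points≡ : 2 ℕ.* suc n ≡ points n 1
    points≡ rewrite ℕ.+-comm n 1 | ℕ.+-identityʳ n = ≡.refl
    to : ∀ {D} → D ∈ filter Q? (diagrams (suc n)) → D ∈ family (2 ℕ.* suc n) 1 L
    to {D} D∈ with ∈-filter⁻ Q? {xs = diagrams (suc n)} D∈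
    ... | D∈ms , q with ∈-filter⁻ isMatching? {xs = tables (2 ℕ.* suc n)} D∈ms
    ...   | _ , M = ∈-family-1 M (Equivalence.to (Q⇔N D M) q)
    from : ∀ {D} → D ∈ family (2 ℕ.* suc n) 1 L → D ∈ filter Q? (diagrams (suc n))
    from {D} D∈ = let M , _ , N = ∈-family⁻ D∈ in
      ∈-filter⁺ Q? (∈-filter⁺ isMatching? (∈-tables D) M) (Equivalence.from (Q⇔N D M) N)

-- Indecomposable and connected diagrams

lookup-⊕ˡ : ∀ {p q} (D : Table p) (E : Table q) a → lookup (D ⊕ E) (a ↑ˡ q) ≡ lookup D a ↑ˡ q
lookup-⊕ˡ {p} {q} D E a = ≡.trans (Vec.lookup-++ˡ (Vec.map (_↑ˡ q) D) _ a) (Vec.lookup-map a (_↑ˡ q) D)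

lookup-⊕ʳ : ∀ {p q} (D : Table p) (E : Table q) b → lookup (D ⊕ E) (p ↑ʳ b) ≡ p ↑ʳ lookup E b
lookup-⊕ʳ {p} {q} D E b = ≡.trans (Vec.lookup-++ʳ (Vec.map (_↑ˡ q) D) _ b) (Vec.lookup-map b (p ↑ʳ_) E)

data Side {p q : ℕ} : Fin (p ℕ.+ q) → Set where
  inLeft  : ∀ a → Side (a ↑ˡ q)
  inRight : ∀ b → Side (p ↑ʳ b)

side : ∀ p {q} (x : Fin (p ℕ.+ q)) → Side {p} {q} x
side p x with splitAt p x in eq
... | inj₁ a = subst Side (Fin.splitAt⁻¹-↑ˡ eq) (inLeft a)
... | inj₂ b = subst Side (Fin.splitAt⁻¹-↑ʳ {p} eq) (inRight b)

-- An involution that preserves a prefix preserves its complement, so both summands can be read off.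
closedPrefix⇒decomposable : ∀ p {q} (D : Table (p ℕ.+ q)) → IsMatching D → 0 < p → 0 < q →
                            Closed 0 p D → Decomposable D
closedPrefix⇒decomposable p {q} D M 0<p 0<q c =
  subst Decomposable (lookup-ext agree) (concatenation D₁ D₂ M₁ M₂ 0<p 0<q)
  where
  image₁ : ∀ a → ∃ λ a′ → lookup D (a ↑ˡ q) ≡ a′ ↑ˡ q
  image₁ a with lookup D (a ↑ˡ q) in eq | side p (lookup D (a ↑ˡ q))
  ... | _ | inLeft a′ = a′ , ≡.refl
  ... | _ | inRight b = contradiction
    (subst (_< p) (≡.trans (cong toℕ eq) (Fin.toℕ-↑ʳ p b))
      (proj₂ (c (a ↑ˡ q) (z≤n , subst (_< p) (≡.sym (Fin.toℕ-↑ˡ a q)) (Fin.toℕ<n a)))))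
    (ℕ.m+n≮m p (toℕ b))
  image₂ : ∀ b → ∃ λ b′ → lookup D (p ↑ʳ b) ≡ p ↑ʳ b′
  image₂ b with lookup D (p ↑ʳ b) in eq | side p (lookup D (p ↑ʳ b))
  ... | _ | inRight b′ = b′ , ≡.refl
  ... | _ | inLeft a  = contradiction
    (subst (_< p) (≡.trans (cong toℕ (≡.trans (cong (lookup D) (≡.sym eq)) (proj₁ (M (p ↑ʳ b))))) (Fin.toℕ-↑ʳ p b))
      (proj₂ (c (a ↑ˡ q) (z≤n , subst (_< p) (≡.sym (Fin.toℕ-↑ˡ a q)) (Fin.toℕ<n a)))))
    (ℕ.m+n≮m p (toℕ b))
  D₁ : Table p
  D₁ = tabulate (proj₁ ∘ image₁)
  D₂ : Table q
  D₂ = tabulate (proj₁ ∘ image₂)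
  D₁-spec : ∀ a → lookup D (a ↑ˡ q) ≡ lookup D₁ a ↑ˡ q
  D₁-spec a = ≡.trans (proj₂ (image₁ a)) (cong (_↑ˡ q) (≡.sym (Vec.lookup∘tabulate (proj₁ ∘ image₁) a)))
  D₂-spec : ∀ b → lookup D (p ↑ʳ b) ≡ p ↑ʳ lookup D₂ b
  D₂-spec b = ≡.trans (proj₂ (image₂ b)) (cong (p ↑ʳ_) (≡.sym (Vec.lookup∘tabulate (proj₁ ∘ image₂) b)))
  M₁ : IsMatching D₁
  M₁ a = Fin.↑ˡ-injective q _ _ (≡.trans (≡.sym (≡.trans (cong (lookup D) (D₁-spec a)) (D₁-spec (lookup D₁ a)))) (proj₁ (M (a ↑ˡ q)))) ,
         λ eq → proj₂ (M (a ↑ˡ q)) (≡.trans (D₁-spec a) (cong (_↑ˡ q) eq))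
  M₂ : IsMatching D₂
  M₂ b = Fin.↑ʳ-injective p _ _ (≡.trans (≡.sym (≡.trans (cong (lookup D) (D₂-spec b)) (D₂-spec (lookup D₂ b)))) (proj₁ (M (p ↑ʳ b)))) ,
         λ eq → proj₂ (M (p ↑ʳ b)) (≡.trans (D₂-spec b) (cong (p ↑ʳ_) eq))
  agree : ∀ x → lookup (D₁ ⊕ D₂) x ≡ lookup D x
  agree x with side p x
  ... | inLeft a  = ≡.trans (lookup-⊕ˡ D₁ D₂ a) (≡.sym (D₁-spec a))
  ... | inRight b = ≡.trans (lookup-⊕ʳ D₁ D₂ b) (≡.sym (D₂-spec b))

-- The cut between two summands is the end of a proper nonempty closed prefix.
indecomposable⇔ : ∀ {m} (D : Table m) → IsMatching D → Indecomposable D ⇔ NoClosed (_≡ᵇ 0) D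
indecomposable⇔ {m} D M = mk⇔ to (λ N dec → from dec N)
  where
  to : Indecomposable D → NoClosed (_≡ᵇ 0) D
  to ind zero q _ 0<q q≤m c with q ℕ.≟ m
  ... | yes q≡m = ≡.refl , q≡m
  ... | no  q≢m = contradiction (split q (m ∸ q) (ℕ.m+[n∸m]≡n q≤m) D M 0<q (ℕ.m<n⇒0<n∸m (ℕ.≤∧≢⇒< q≤m q≢m)) c) ind
    where
    split : ∀ p q {m} → p ℕ.+ q ≡ m → (D : Table m) → IsMatching D → 0 < p → 0 < q → Closed 0 p D → Decomposable D
    split p q ≡.refl = closedPrefix⇒decomposable p
  from : ∀ {m} {D : Table m} → Decomposable D → ¬ NoClosed (_≡ᵇ 0) D
  from (concatenation {p} {q} D₁ D₂ _ _ 0<p 0<q) N =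
    ℕ.<-irrefl (proj₂ (N 0 p ≡.refl 0<p (ℕ.m≤m+n p q) c)) (ℕ.m<m+n p 0<q)
    where
    c : Closed 0 p (D₁ ⊕ D₂)
    c x (_ , x<p) with side p x
    ... | inLeft a  rewrite lookup-⊕ˡ D₁ D₂ a | Fin.toℕ-↑ˡ (lookup D₁ a) q = z≤n , Fin.toℕ<n (lookup D₁ a)
    ... | inRight b = contradiction (subst (_< p) (Fin.toℕ-↑ʳ p b) x<p) (ℕ.m+n≮m p (toℕ b))

module Connectivity {m : ℕ} (D : Table m) (M : IsMatching D) where

  chordOf : Fin m → Chord m
  chordOf a with a Fin.<? lookup D a
  ... | yes _ = a , lookup D a
  ... | no  _ = lookup D a , a

  chordOf-cases : ∀ a → (chordOf a ≡ (a , lookup D a) × a Fin.< lookup D a) ⊎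
                        (chordOf a ≡ (lookup D a , a) × lookup D a Fin.< a)
  chordOf-cases a with a Fin.<? lookup D a
  ... | yes a<Da = inj₁ (≡.refl , a<Da)
  ... | no  a≮Da = inj₂ (≡.refl , ℕ.≤∧≢⇒< (ℕ.≮⇒≥ a≮Da) (proj₂ (M a) ∘ Fin.toℕ-injective))

  chordOf-isChord : ∀ a → IsChord D (chordOf a)
  chordOf-isChord a with chordOf-cases a
  ... | inj₁ (eq , a<Da) rewrite eq = a<Da , ≡.refl
  ... | inj₂ (eq , Da<a) rewrite eq = Da<a , proj₁ (M a)

  chordOf-opener : ∀ {a b} → IsChord D (a , b) → chordOf a ≡ (a , b)
  chordOf-opener {a} (a<b , ≡.refl) with chordOf-cases a
  ... | inj₁ (eq , _)    = eq
  ... | inj₂ (_ , Da<a) = contradiction a<b (ℕ.<⇒≯ Da<a)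

  chordOf-partner : ∀ a → chordOf (lookup D a) ≡ chordOf a
  chordOf-partner a with chordOf-cases a | chordOf-cases (lookup D a)
  ... | inj₁ (eq , _)   | inj₂ (eq′ , _)    = ≡.trans eq′ (≡.trans (cong (_, lookup D a) (proj₁ (M a))) (≡.sym eq))
  ... | inj₂ (eq , _)   | inj₁ (eq′ , _)    = ≡.trans eq′ (≡.trans (cong (lookup D a ,_) (proj₁ (M a))) (≡.sym eq))
  ... | inj₁ (_ , a<Da) | inj₁ (_ , Da<DDa) = contradiction (subst (lookup D a Fin.<_) (proj₁ (M a)) Da<DDa) (ℕ.<⇒≯ a<Da)
  ... | inj₂ (_ , Da<a) | inj₂ (_ , DDa<Da) = contradiction (subst (Fin._< lookup D a) (proj₁ (M a)) DDa<Da) (ℕ.<⇒≯ Da<a)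

  closed-partner : ∀ {p q} → Closed p q D → ∀ a → Inside p q (lookup D a) → Inside p q a
  closed-partner {p} {q} c a in-Da = subst (Inside p q) (proj₁ (M a)) (c (lookup D a) in-Da)

  -- Of two crossing chords, each has an end strictly between the ends of the other. A closed
  -- interval containing one chord contains this end, hence both ends of the other chord.
  closed-edge : ∀ {p q} → Closed p q D → ∀ {c d} → Edge D c d → Inside p q (proj₁ c) → Inside p q (proj₁ d)
  closed-edge c {a , _} {x , _} ((_ , ≡.refl) , _ , inj₁ (a<x , x<b , _)) (p≤a , a<q) =
    ℕ.≤-trans p≤a (ℕ.<⇒≤ a<x) , ℕ.<-trans x<b (proj₂ (c a (p≤a , a<q)))
  closed-edge c {a , _} {x , _} ((_ , ≡.refl) , (_ , ≡.refl) , inj₂ (_ , a<y , y<b)) (p≤a , a<q) =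
    closed-partner c x (ℕ.≤-trans p≤a (ℕ.<⇒≤ a<y) , ℕ.<-trans y<b (proj₂ (c a (p≤a , a<q))))

  closed-star : ∀ {p q} → Closed p q D → ∀ {c d} → Star (Edge D) c d → Inside p q (proj₁ c) → Inside p q (proj₁ d)
  closed-star c ε        in-c = in-c
  closed-star c (e ◅ es) in-c = closed-star c es (closed-edge c e in-c)

  inside-chordOf : ∀ {p q} → Closed p q D → ∀ a → Inside p q (proj₁ (chordOf a)) ⇔ Inside p q a
  inside-chordOf {p} {q} c a with chordOf-cases a
  ... | inj₁ (eq , _) rewrite eq = mk⇔ (λ i → i) (λ i → i)
  ... | inj₂ (eq , _) rewrite eq = mk⇔ (closed-partner c a) (c a)

  -- Paths in the crossing graph never leave a closed interval, so in a connected diagram a nonempty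
  -- one must contain every point.
  connected⇒noClosed : Connected D → NoClosed (λ _ → true) D
  connected⇒noClosed conn p q _ p<q q≤m c = ℕ.n≤0⇒n≡0 (proj₁ (inside 0 0<m)) , q≡m
    where
    p<m : p < m
    p<m = ℕ.<-≤-trans p<q q≤m
    0<m : 0 < m
    0<m = ℕ.≤-<-trans z≤n p<m
    at-p : Fin m
    at-p = fromℕ< p<m
    inside-p : Inside p q at-p
    inside-p rewrite Fin.toℕ-fromℕ< p<m = ℕ.≤-refl , p<q
    inside : ∀ n → n < m → p ≤ n × n < q
    inside n n<m = subst (λ n → p ≤ n × n < q) (Fin.toℕ-fromℕ< n<m)
      (Equivalence.to (inside-chordOf c x)
        (closed-star c (conn (chordOf at-p) (chordOf x) (chordOf-isChord at-p) (chordOf-isChord x))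
          (Equivalence.from (inside-chordOf c at-p) inside-p)))
      where
      x : Fin m
      x = fromℕ< n<m
    q≡m : q ≡ m
    q≡m with q ℕ.≟ m
    ... | yes eq  = eq
    ... | no  q≢m = contradiction (proj₂ (inside q (ℕ.≤∧≢⇒< q≤m q≢m))) (ℕ.<-irrefl ≡.refl)

  edge-sym : Symmetric (Edge D)
  edge-sym (c , d , inj₁ x) = d , c , inj₂ x
  edge-sym (c , d , inj₂ x) = d , c , inj₁ x

  module Component (o : Fin m) (o≡0 : toℕ o ≡ 0) where

    root : Chord m
    root = chordOf o

    InRoot : Fin m → Set
    InRoot a = Star (Edge D) root (chordOf a)

    inRoot? : U.Decidable InRoot
    inRoot? a = star? ∈-allPairs root (chordOf a)
      where open Reachability (Product.≡-dec Fin._≟_ Fin._≟_) (edge? D)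

    inRoot-partner : ∀ {a} → InRoot (lookup D a) → InRoot a
    inRoot-partner {a} = subst (Star (Edge D) root) (chordOf-partner a)

    -- The chords of the root component lie on one side of every other chord.
    module _ {s t : Fin m} (st : IsChord D (s , t)) (s∉ : ¬ InRoot s) where

      Between : Fin m → Set
      Between e = s Fin.< e × e Fin.< t

      noCross : ∀ {a b} → IsChord D (a , b) → InRoot a → ¬ Crosses (a , b) (s , t)
      noCross {a} ab a∈ x = s∉ (subst (Star (Edge D) root) (≡.sym (chordOf-opener st))
        (subst (Star (Edge D) root) (chordOf-opener ab) a∈ ◅◅ (ab , st , x) ◅ ε))

      inRoot-≢s : ∀ {e} → InRoot e → toℕ e ≢ toℕ s
      inRoot-≢s e∈ e≡s = s∉ (subst InRoot (Fin.toℕ-injective e≡s) e∈)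

      inRoot-≢t : ∀ {e} → InRoot e → toℕ e ≢ toℕ t
      inRoot-≢t e∈ e≡t = s∉ (inRoot-partner (subst InRoot (≡.trans (Fin.toℕ-injective e≡t) (≡.sym (proj₂ st))) e∈))

      inRoot-closer : ∀ {a b} → IsChord D (a , b) → InRoot a → InRoot b
      inRoot-closer {a} (_ , ≡.refl) = subst (Star (Edge D) root) (≡.sym (chordOf-partner a))

      between-closer : ∀ {a b} → IsChord D (a , b) → InRoot a → Between a → Between b
      between-closer {a} {b} ab a∈ (s<a , a<t) with ℕ.<-cmp (toℕ b) (toℕ t)
      ... | tri< b<t _ _ = ℕ.<-trans s<a (proj₁ ab) , b<t
      ... | tri≈ _ b≡t _ = contradiction b≡t (inRoot-≢t (inRoot-closer ab a∈))
      ... | tri> _ _ t<b = contradiction (inj₂ (s<a , a<t , t<b)) (noCross ab a∈)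

      between-opener : ∀ {a b} → IsChord D (a , b) → InRoot a → Between b → Between a
      between-opener {a} {b} ab a∈ (s<b , b<t) with ℕ.<-cmp (toℕ a) (toℕ s)
      ... | tri< a<s _ _ = contradiction (inj₁ (a<s , s<b , b<t)) (noCross ab a∈)
      ... | tri≈ _ a≡s _ = contradiction a≡s (inRoot-≢s a∈)
      ... | tri> _ _ s<a = s<a , ℕ.<-trans (proj₁ ab) b<t

      -- Both ends of d lie between s and t. The crossing chord c has an end between those of d, and
      -- since c does not cross (s , t), its opener lies there too.
      between-edge : ∀ {c d} → InRoot (proj₁ c) → InRoot (proj₁ d) → Edge D c d → Between (proj₁ d) → Between (proj₁ c)
      between-edge {a , b} {x , y} a∈ x∈ (ab , xy , inj₁ (_ , x<b , b<y)) x-in =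
        let _ , y<t = between-closer xy x∈ x-in in
        between-opener ab a∈ (ℕ.<-trans (proj₁ x-in) x<b , ℕ.<-trans b<y y<t)
      between-edge {a , b} {x , y} a∈ x∈ (ab , xy , inj₂ (x<a , a<y , _)) x-in =
        let _ , y<t = between-closer xy x∈ x-in in
        ℕ.<-trans (proj₁ x-in) x<a , ℕ.<-trans a<y y<t

      between-star : ∀ {c d} → IsChord D c → Star (Edge D) root c → Star (Edge D) c d →
                     Between (proj₁ d) → Between (proj₁ c)
      between-star ck r ε in-d = in-d
      between-star {c} ck r (_◅_ {j = d} e@(_ , dk , _) es) in-d =
        between-edge (subst (Star (Edge D) root) (≡.sym (chordOf-opener ck)) r)
                     (subst (Star (Edge D) root) (≡.sym (chordOf-opener dk)) r′) e
                     (between-star dk r′ es in-d)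
        where
        r′ : Star (Edge D) root d
        r′ = r ◅◅ e ◅ ε

      root-opener : proj₁ root ≡ o
      root-opener with chordOf-cases o
      ... | inj₁ (eq , _)    = cong proj₁ eq
      ... | inj₂ (_ , Do<o) = contradiction (subst (toℕ (lookup D o) <_) o≡0 Do<o) ℕ.n≮0

      -- Betweenness is carried back along the path to the root chord, whose opener is point 0;
      -- nothing lies to the left of 0.
      not-between : ∀ {e} → InRoot e → ¬ Between e
      not-between {e} e∈ e-in = ℕ.n≮0 (subst (toℕ s <_) o≡0 (subst (s Fin.<_) root-opener
        (proj₁ (between-star (chordOf-isChord o) ε e∈ opener-in))))
        where
        opener-in : Between (proj₁ (chordOf e))
        opener-in with chordOf-cases e
        ... | inj₁ (eq , _)    = subst (Between ∘ proj₁) (≡.sym eq) e-in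
        ... | inj₂ (eq , De<e) = subst (Between ∘ proj₁) (≡.sym eq)
          (between-opener (De<e , proj₁ (M e)) (subst (Star (Edge D) root) (≡.sym (chordOf-partner e)) e∈) e-in)

    InRootAt : ℕ → Set
    InRootAt n = ∃ λ a → toℕ a ≡ n × InRoot a

    inRootAt? : U.Decidable InRootAt
    inRootAt? n = Fin.any? λ a → (toℕ a ℕ.≟ n) ×-dec inRoot? a

    -- Point 0 is in the root component, so a descent from n must meet the component.
    gapStart : ∀ n → ¬ InRootAt n →
      ∃ λ p → InRootAt p × p < n × (∀ k → p < k → k ≤ n → ¬ InRootAt k)
    gapStart zero    n∉ = contradiction (o , o≡0 , ε) n∉
    gapStart (suc n) n∉ with inRootAt? n
    ... | yes n∈ = n , n∈ , ℕ.n<1+n n , λ k n<k k≤n → subst (¬_ ∘ InRootAt) (ℕ.≤-antisym n<k k≤n) n∉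
    ... | no n∉′ with gapStart n n∉′
    ...   | p , p∈ , p<n , free = p , p∈ , ℕ.m<n⇒m<1+n p<n , free′
      where
      free′ : ∀ k → p < k → k ≤ suc n → ¬ InRootAt k
      free′ k p<k k≤1+n with k ℕ.≟ suc n
      ... | yes ≡.refl  = n∉
      ... | no  k≢1+n = free k p<k (s≤s⁻¹ (ℕ.≤∧≢⇒< k≤1+n k≢1+n))

    -- The upward search is by induction on the number r of points left; if it meets no point of the
    -- component, the run ends at m.
    gapEnd : ∀ r n → n ℕ.+ r ≡ m → ∃ λ q → n ≤ q × q ≤ m × (q < m → InRootAt q) ×
             (∀ k → n ≤ k → k < q → ¬ InRootAt k)
    gapEnd zero n eq = n , ℕ.≤-refl , ℕ.≤-reflexive n≡m , (λ n<m → contradiction n≡m (ℕ.<⇒≢ n<m)) ,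
      λ k n≤k k<n → contradiction k<n (ℕ.≤⇒≯ n≤k)
      where
      n≡m : n ≡ m
      n≡m = ≡.trans (≡.sym (ℕ.+-identityʳ n)) eq
    gapEnd (suc r) n eq with inRootAt? n
    ... | yes n∈ = n , ℕ.≤-refl , subst (n ≤_) eq (ℕ.m≤m+n n (suc r)) , (λ _ → n∈) ,
      λ k n≤k k<n → contradiction k<n (ℕ.≤⇒≯ n≤k)
    ... | no  n∉ with gapEnd r (suc n) (≡.trans (≡.sym (ℕ.+-suc n r)) eq)
    ...   | q , n<q , q≤m , q∈ , free = q , ℕ.<⇒≤ n<q , q≤m , q∈ , free′
      where
      free′ : ∀ k → n ≤ k → k < q → ¬ InRootAt k
      free′ k n≤k k<q with n ℕ.≟ k
      ... | yes ≡.refl = n∉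
      ... | no  n≢k  = free k (ℕ.≤∧≢⇒< n≤k n≢k) k<q

    inRootAt⇒ : ∀ {a} → InRootAt (toℕ a) → InRoot a
    inRootAt⇒ (b , b≡a , b∈) = subst InRoot (Fin.toℕ-injective b≡a) b∈

    -- A maximal run of points outside the root component would be a proper closed interval.
    all-inRoot : NoClosed (λ _ → true) D → ∀ a → InRoot a
    all-inRoot N a with inRoot? a
    ... | yes a∈ = a∈
    ... | no  a∉ with gapStart (toℕ a) (a∉ ∘ inRootAt⇒) | gapEnd (m ∸ toℕ a) (toℕ a) (ℕ.m+[n∸m]≡n (ℕ.<⇒≤ (Fin.toℕ<n a)))
    ...   | p , (x , ≡.refl , x∈) , x<a , free | q , a≤q , q≤m , q∈ , free′ =
      contradiction (proj₁ (N (suc (toℕ x)) q ≡.refl (ℕ.≤-<-trans x<a a<q) q≤m closed)) λ ()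
      where
      a<q : toℕ a < q
      a<q with toℕ a ℕ.≟ q
      ... | no a≢q   = ℕ.≤∧≢⇒< a≤q a≢q
      ... | yes ≡.refl = contradiction (inRootAt⇒ (q∈ (Fin.toℕ<n a))) a∉
      outside : ∀ y → Inside (suc (toℕ x)) q y → ¬ InRoot y
      outside y (x<y , y<q) y∈ with toℕ y ℕ.≤? toℕ a
      ... | yes y≤a = free (toℕ y) x<y y≤a (y , ≡.refl , y∈)
      ... | no  y≰a = free′ (toℕ y) (ℕ.<⇒≤ (ℕ.≰⇒> y≰a)) y<q (y , ≡.refl , y∈)
      -- A chord leaving the run would end at, or stretch over, its neighbour x or q, which is in
      -- the root component; `not-between` forbids the latter.
      closed : Closed (suc (toℕ x)) q D
      closed y in-y@(x<y , y<q) = ℕ.≰⇒> Dy≰x , ℕ.≰⇒> q≰Dy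
        where
        Dy∉ : ¬ InRoot (lookup D y)
        Dy∉ = outside y in-y ∘ inRoot-partner
        Dy≰x : ¬ toℕ (lookup D y) ≤ toℕ x
        Dy≰x Dy≤x = not-between (ℕ.≤-<-trans Dy≤x x<y , proj₁ (M y)) Dy∉ x∈
          (ℕ.≤∧≢⇒< Dy≤x (λ eq → Dy∉ (subst InRoot (≡.sym (Fin.toℕ-injective eq)) x∈)) , x<y)
        q≰Dy : ¬ q ≤ toℕ (lookup D y)
        q≰Dy q≤Dy with q∈ (ℕ.≤-<-trans q≤Dy (Fin.toℕ<n (lookup D y)))
        ... | z , ≡.refl , z∈ = not-between (ℕ.<-≤-trans y<q q≤Dy , ≡.refl) (outside y in-y) z∈
          (y<q , ℕ.≤∧≢⇒< q≤Dy (λ eq → Dy∉ (subst InRoot (Fin.toℕ-injective eq) z∈)))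

  noClosed⇒connected : NoClosed (λ _ → true) D → Connected D
  noClosed⇒connected N c@(a , _) d@(b , _) ck dk =
    reverse edge-sym (reach c ck) ◅◅ reach d dk
    where
    0<m : 0 < m
    0<m = ℕ.≤-<-trans z≤n (Fin.toℕ<n a)
    open Component (fromℕ< 0<m) (Fin.toℕ-fromℕ< 0<m)
    reach : ∀ c → IsChord D c → Star (Edge D) root c
    reach (a , b) ck = subst (Star (Edge D) root) (chordOf-opener ck) (all-inRoot N a)

connected⇔ : ∀ {m} (D : Table m) → IsMatching D → Connected D ⇔ NoClosed (λ _ → true) D
connected⇔ D M = mk⇔ connected⇒noClosed noClosed⇒connected
  where open Connectivity D M

-- Polynomials

-- Polynomials are compared as linear functionals on all weights f : ℕ → ℕ → ℤ.
-- This implies equality of coefficients, and products are then manifestly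
-- compatible with it.
⟦_⟧ : Poly → (ℕ → ℕ → ℤ) → ℤ
⟦ [] ⟧                f = 0ℤ
⟦ (k u^ i v^ j) ∷ p ⟧ f = k ℤ.* f i j ℤ.+ ⟦ p ⟧ f

infix 4 _≃_
record _≃_ (p q : Poly) : Set where
  constructor mk≃
  field
    applied : ∀ f → ⟦ p ⟧ f ≡ ⟦ q ⟧ f

open _≃_

-- Reading off a coefficient is itself evaluation at a weight, the indicator of one exponent pair.
≃⇒≈ᴾ : ∀ {p q} → p ≃ q → p ≈ᴾ q
≃⇒≈ᴾ {p} {q} p≃q i j = ≡.trans (coeff-δ p) (≡.trans (applied p≃q δ) (≡.sym (coeff-δ q)))
  where
  δ : ℕ → ℕ → ℤ
  δ i′ j′ = if ⌊ (i′ ℕ.≟ i) ×-dec (j′ ℕ.≟ j) ⌋ then 1ℤ else 0ℤ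
  if-* : ∀ b k → (if b then k else 0ℤ) ≡ k ℤ.* (if b then 1ℤ else 0ℤ)
  if-* true  k = ≡.sym (ℤ.*-identityʳ k)
  if-* false k = ≡.sym (ℤ.*-zeroʳ k)
  coeff-δ : ∀ p → coeff p i j ≡ ⟦ p ⟧ δ
  coeff-δ []                    = ≡.refl
  coeff-δ ((k u^ i′ v^ j′) ∷ p) = cong₂ ℤ._+_ (if-* _ k) (coeff-δ p)

⟦⟧-cong : ∀ p {f g} → (∀ i j → f i j ≡ g i j) → ⟦ p ⟧ f ≡ ⟦ p ⟧ g
⟦⟧-cong []                  f≗g = ≡.refl
⟦⟧-cong ((k u^ i v^ j) ∷ p) f≗g = cong₂ ℤ._+_ (cong (k ℤ.*_) (f≗g i j)) (⟦⟧-cong p f≗g)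

⟦⟧-zero : ∀ p → ⟦ p ⟧ (λ _ _ → 0ℤ) ≡ 0ℤ
⟦⟧-zero []                  = ≡.refl
⟦⟧-zero ((k u^ i v^ j) ∷ p) = cong₂ ℤ._+_ (ℤ.*-zeroʳ k) (⟦⟧-zero p)

⟦⟧-linear : ∀ p a f g → ⟦ p ⟧ (λ i j → a ℤ.* f i j ℤ.+ g i j) ≡ a ℤ.* ⟦ p ⟧ f ℤ.+ ⟦ p ⟧ g
⟦⟧-linear []                  a f g = ≡.sym (≡.trans (ℤ.+-identityʳ _) (ℤ.*-zeroʳ a))
⟦⟧-linear ((k u^ i v^ j) ∷ p) a f g rewrite ⟦⟧-linear p a f g =
  solve 6 (λ k a x y s t → k :* (a :* x :+ y) :+ (a :* s :+ t) := a :* (k :* x :+ s) :+ (k :* y :+ t))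
    ≡.refl k a (f i j) (g i j) (⟦ p ⟧ f) (⟦ p ⟧ g)
  where
  open import Data.Integer.Solver using (module +-*-Solver)
  open +-*-Solver hiding (⟦_⟧)

-- Interchange of two finite sums; commutativity of the product rests on it.
⟦⟧-swap : ∀ p q (F : ℕ → ℕ → ℕ → ℕ → ℤ) →
  ⟦ p ⟧ (λ i j → ⟦ q ⟧ (F i j)) ≡ ⟦ q ⟧ (λ i′ j′ → ⟦ p ⟧ (λ i j → F i j i′ j′))
⟦⟧-swap []                  q F = ≡.sym (⟦⟧-zero q)
⟦⟧-swap ((k u^ i v^ j) ∷ p) q F = begin
  k ℤ.* ⟦ q ⟧ (F i j) ℤ.+ ⟦ p ⟧ (λ i j → ⟦ q ⟧ (F i j))
    ≡⟨ cong (λ s → k ℤ.* ⟦ q ⟧ (F i j) ℤ.+ s) (⟦⟧-swap p q F) ⟩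
  k ℤ.* ⟦ q ⟧ (F i j) ℤ.+ ⟦ q ⟧ (λ i′ j′ → ⟦ p ⟧ (λ i j → F i j i′ j′))
    ≡⟨ ⟦⟧-linear q k (F i j) _ ⟨
  ⟦ q ⟧ (λ i′ j′ → k ℤ.* F i j i′ j′ ℤ.+ ⟦ p ⟧ (λ i j → F i j i′ j′)) ∎
  where open ≡.≡-Reasoning

⟦+⟧ : ∀ p q f → ⟦ p +ᴾ q ⟧ f ≡ ⟦ p ⟧ f ℤ.+ ⟦ q ⟧ f
⟦+⟧ []                  q f = ≡.sym (ℤ.+-identityˡ _)
⟦+⟧ ((k u^ i v^ j) ∷ p) q f =
  ≡.trans (cong (ℤ._+_ (k ℤ.* f i j)) (⟦+⟧ p q f)) (≡.sym (ℤ.+-assoc (k ℤ.* f i j) _ _))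

⟦-⟧ : ∀ p f → ⟦ -ᴾ p ⟧ f ≡ ℤ.- ⟦ p ⟧ f
⟦-⟧ []                  f = ≡.refl
⟦-⟧ ((k u^ i v^ j) ∷ p) f =
  ≡.trans (cong₂ ℤ._+_ (≡.sym (ℤ.neg-distribˡ-* k (f i j))) (⟦-⟧ p f)) (≡.sym (ℤ.neg-distrib-+ (k ℤ.* f i j) _))

-- Multiplying monomials adds exponents, so a product acts by iterating functionals on translated
-- weights. The laws of the product thereby reduce to those of addition on exponents.
⟦*⟧ : ∀ p q f → ⟦ p *ᴾ q ⟧ f ≡ ⟦ p ⟧ (λ i j → ⟦ q ⟧ (λ i′ j′ → f (i ℕ.+ i′) (j ℕ.+ j′)))
⟦*⟧ []                  q f = ≡.refl
⟦*⟧ ((k u^ i v^ j) ∷ p) q f =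
  ≡.trans (⟦+⟧ (map scale q) (p *ᴾ q) f) (cong₂ ℤ._+_ (⟦scale⟧ q) (⟦*⟧ p q f))
  where
  scale : Term → Term
  scale (k′ u^ i′ v^ j′) = (k ℤ.* k′) u^ (i ℕ.+ i′) v^ (j ℕ.+ j′)
  ⟦scale⟧ : ∀ q → ⟦ map scale q ⟧ f ≡ k ℤ.* ⟦ q ⟧ (λ i′ j′ → f (i ℕ.+ i′) (j ℕ.+ j′))
  ⟦scale⟧ []                     = ≡.sym (ℤ.*-zeroʳ k)
  ⟦scale⟧ ((k′ u^ i′ v^ j′) ∷ q) =
    ≡.trans (cong₂ ℤ._+_ (ℤ.*-assoc k k′ _) (⟦scale⟧ q)) (≡.sym (ℤ.*-distribˡ-+ k _ _))

≃-isEquivalence : IsEquivalence _≃_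
≃-isEquivalence = record
  { refl  = mk≃ λ f → ≡.refl
  ; sym   = λ p≃q → mk≃ λ f → ≡.sym (applied p≃q f)
  ; trans = λ p≃q q≃r → mk≃ λ f → ≡.trans (applied p≃q f) (applied q≃r f)
  }

Poly-isCommutativeSemiring : IsCommutativeSemiring _≃_ _+ᴾ_ _*ᴾ_ 0ᴾ 1ᴾ
Poly-isCommutativeSemiring = Biased.isCommutativeSemiringˡ record
  { +-isCommutativeMonoid = Biased.isCommutativeMonoidˡ record
    { isSemigroup = record
      { isMagma = record
        { isEquivalence = ≃-isEquivalence
        ; ∙-cong = λ {p} {p′} {q} {q′} p≃p′ q≃q′ → mk≃ λ f →
            ≡.trans (⟦+⟧ p q f) (≡.trans (cong₂ ℤ._+_ (applied p≃p′ f) (applied q≃q′ f)) (≡.sym (⟦+⟧ p′ q′ f)))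
        }
      ; assoc = λ p q r → mk≃ λ f → cong (λ s → ⟦ s ⟧ f) (List.++-assoc p q r)
      }
    ; identityˡ = λ p → mk≃ λ f → ≡.refl
    ; comm = λ p q → mk≃ λ f →
        ≡.trans (⟦+⟧ p q f) (≡.trans (ℤ.+-comm (⟦ p ⟧ f) _) (≡.sym (⟦+⟧ q p f)))
    }
  ; *-isCommutativeMonoid = Biased.isCommutativeMonoidˡ record
    { isSemigroup = record
      { isMagma = record
        { isEquivalence = ≃-isEquivalence
        ; ∙-cong = λ {p} {p′} {q} {q′} p≃p′ q≃q′ → mk≃ λ f →
            ≡.trans (⟦*⟧ p q f) (≡.trans (⟦⟧-cong p (λ i j → applied q≃q′ _))
              (≡.trans (applied p≃p′ _) (≡.sym (⟦*⟧ p′ q′ f))))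
        }
      ; assoc = λ p q r → mk≃ λ f → ≡.trans (⟦*⟧ (p *ᴾ q) r f) (≡.trans (⟦*⟧ p q _)
          (≡.trans (⟦⟧-cong p λ i j → ≡.trans (⟦⟧-cong q λ i′ j′ → ⟦⟧-cong r λ i″ j″ →
                    cong₂ f (ℕ.+-assoc i i′ i″) (ℕ.+-assoc j j′ j″)) (≡.sym (⟦*⟧ q r _)))
                 (≡.sym (⟦*⟧ p (q *ᴾ r) f))))
      }
    ; identityˡ = λ p → mk≃ λ f → ≡.trans (⟦*⟧ 1ᴾ p f)
        (≡.trans (ℤ.+-identityʳ _) (ℤ.*-identityˡ (⟦ p ⟧ f)))
    ; comm = λ p q → mk≃ λ f → ≡.trans (⟦*⟧ p q f) (≡.trans (⟦⟧-swap p q _)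
        (≡.trans (⟦⟧-cong q λ i j → ⟦⟧-cong p λ i′ j′ → cong₂ f (ℕ.+-comm i′ i) (ℕ.+-comm j′ j))
               (≡.sym (⟦*⟧ q p f))))
    }
  ; distribʳ = λ p q r → mk≃ λ f → ≡.trans (⟦*⟧ (q +ᴾ r) p f) (≡.trans (⟦+⟧ q r _)
      (≡.trans (cong₂ ℤ._+_ (≡.sym (⟦*⟧ q p f)) (≡.sym (⟦*⟧ r p f))) (≡.sym (⟦+⟧ (q *ᴾ p) (r *ᴾ p) f))))
  ; zeroˡ = λ p → mk≃ λ f → ≡.refl
  }

Poly-commutativeSemiring : CommutativeSemiring 0ℓ 0ℓ
Poly-commutativeSemiring = record { isCommutativeSemiring = Poly-isCommutativeSemiring }

+ᴾ-inverseʳ : ∀ p → p +ᴾ -ᴾ p ≃ 0ᴾ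
+ᴾ-inverseʳ p = mk≃ λ f →
  ≡.trans (⟦+⟧ p (-ᴾ p) f) (≡.trans (cong (ℤ._+_ (⟦ p ⟧ f)) (⟦-⟧ p f)) (ℤ.+-inverseʳ (⟦ p ⟧ f)))

module Poly = CommutativeSemiring Poly-commutativeSemiring
open import Algebra.Properties.Semiring.Exp Poly.semiring using (_^_)

^ᴾ≡^ : ∀ p n → p ^ᴾ n ≡ p ^ n
^ᴾ≡^ p zero    = ≡.refl
^ᴾ≡^ p (suc n) = cong (p *ᴾ_) (^ᴾ≡^ p n)

u^≃ : ∀ n → uᴾ ^ n ≃ [ 1ℤ u^ n v^ 0 ]
u^≃ zero    = Poly.refl
u^≃ (suc n) = Poly.*-congˡ {uᴾ} (u^≃ n)

v^≃ : ∀ n → vᴾ ^ n ≃ [ 1ℤ u^ 0 v^ n ]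
v^≃ zero    = Poly.refl
v^≃ (suc n) = Poly.*-congˡ {vᴾ} (v^≃ n)

term≃ : ∀ i j → [ 1ℤ u^ i v^ j ] ≃ uᴾ ^ i *ᴾ vᴾ ^ j
term≃ i j = Poly.sym (Poly.trans (Poly.*-cong (u^≃ i) (v^≃ j))
  (Poly.reflexive (cong (λ i → [ 1ℤ u^ i v^ j ]) (ℕ.+-identityʳ i))))

-- Diagram sums and their generating functions

open Weights Poly-commutativeSemiring vᴾ

sum-weights : ∀ {m} (Ds : List (Table m)) → sumᴾ (map weight Ds) ≃ total uᴾ Ds
sum-weights []       = Poly.refl
sum-weights (D ∷ Ds) = Poly.+-cong (term≃ (top D) (cr D)) (sum-weights Ds)

-- Substituting q for u gives each top chord the weight q from the start; this is why the
-- enumeration allows an arbitrary weight x.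
substU-weights : ∀ {m} q (Ds : List (Table m)) → substU q (sumᴾ (map weight Ds)) ≃ total q Ds
substU-weights q []       = Poly.refl
substU-weights q (D ∷ Ds) = Poly.+-cong
  (Poly.trans (Poly.*-cong (Poly.sym (v^≃ (cr D))) (Poly.reflexive (^ᴾ≡^ q (top D))))
              (Poly.*-comm (vᴾ ^ cr D) (q ^ top D)))
  (substU-weights q Ds)

open Paths Poly-commutativeSemiring vᴾ
open import Algebra.Properties.Semiring.Sum Poly.semiring using (sum; sum-cong-≋)

sumᴾ-applyUpTo : ∀ (f : ℕ → Poly) n → sumᴾ (applyUpTo f n) ≡ sum {n} (λ k → f (toℕ k))
sumᴾ-applyUpTo f zero    = ≡.refl
sumᴾ-applyUpTo f (suc n) = cong (f 0 +ᴾ_) (sumᴾ-applyUpTo (f ∘ suc) n)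

*≡conv : ∀ F G n → (F Defs.* G) n ≡ conv F G n
*≡conv F G n = ≡.trans (cong sumᴾ (List.map-upTo _ (suc n))) (sumᴾ-applyUpTo (λ i → F i *ᴾ G (n ∸ i)) (suc n))

conv-const-1 : ∀ F n → conv (const 1ᴾ) F n ≃ F n
conv-const-1 F zero    = Poly.trans (Poly.+-identityʳ _) (Poly.*-identityˡ (F 0))
conv-const-1 F (suc n) = Poly.trans (Poly.+-cong (Poly.*-identityˡ (F (suc n))) (conv-0 F n)) (Poly.+-identityʳ _)

z*≃shift : ∀ F n → (z Defs.* F) n ≃ shift F n
z*≃shift F n = begin
  (z Defs.* F) n              ≡⟨ *≡conv z F n ⟩
  conv z F n                  ≈⟨ conv-congˡ F n z≃shift ⟩
  conv (shift (const 1ᴾ)) F n ≈⟨ conv-shift (const 1ᴾ) F n ⟩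
  shift (conv (const 1ᴾ) F) n ≈⟨ shift-cong (conv-const-1 F) n ⟩
  shift F n                   ∎
  where
  open import Relation.Binary.Reasoning.Setoid Poly.setoid
  z≃shift : ∀ n → z n ≃ shift (const 1ᴾ) n
  z≃shift 0             = Poly.refl
  z≃shift 1             = Poly.refl
  z≃shift (suc (suc n)) = Poly.refl

conv-cong : ∀ {F F′ G G′} n → (∀ k → F k ≃ F′ k) → (∀ k → G k ≃ G′ k) → conv F G n ≃ conv F′ G′ n
conv-cong n F≃F′ G≃G′ = sum-cong-≋ {suc n} λ k → Poly.*-cong (F≃F′ (toℕ k)) (G≃G′ (n ∸ toℕ k))

z*-* : ∀ F G n → (z Defs.* F Defs.* G) n ≃ shift (conv F G) n
z*-* F G n = begin
  (z Defs.* F Defs.* G) n ≡⟨ *≡conv (z Defs.* F) G n ⟩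
  conv (z Defs.* F) G n   ≈⟨ conv-congˡ G n (z*≃shift F) ⟩
  conv (shift F) G n      ≈⟨ conv-shift F G n ⟩
  shift (conv F G) n      ∎
  where open import Relation.Binary.Reasoning.Setoid Poly.setoid

module GeneratingFunction
  {Q : ∀ {m} → Table m → Set} (Q? : ∀ {m} → U.Decidable (Q {m})) (L⁰ : ℕ → Bool) (φ : Bool)
  (L⁰0 : L⁰ 0 ≡ true) (L⁰φ : ∀ p → L⁰ (suc p) ≡ φ)
  (Q⇔noClosed : ∀ {m} (D : Table m) → IsMatching D → Q D ⇔ NoClosed L⁰ D) where

  F : Series
  F n = sumᴾ (map weight (filter Q? (diagrams (suc n))))

  total≃ : ∀ q n → total q (filter Q? (diagrams (suc n))) ≃ pathSum q n 1 L⁰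
  total≃ q = Enumeration.total≈pathSum Poly-commutativeSemiring vᴾ q Q? L⁰0 Q⇔noClosed

  F≃ : ∀ n → F n ≃ pathSum uᴾ n 1 L⁰
  F≃ n = Poly.trans (sum-weights (filter Q? (diagrams (suc n)))) (total≃ uᴾ n)

  F[u≔]≃ : ∀ q n → substU q (F n) ≃ pathSum q n 1 L⁰
  F[u≔]≃ q n = Poly.trans (substU-weights q (filter Q? (diagrams (suc n)))) (total≃ q n)

  open FirstReturn uᴾ φ L⁰ L⁰0 L⁰φ
  open import Relation.Binary.Reasoning.Setoid Poly.setoid

  monomial≡const : ∀ n → monomial n ≡ const uᴾ n
  monomial≡const zero    = ≡.refl
  monomial≡const (suc n) = ≡.refl

  merged-series : Merged φ 1 L⁰ L⁰ → F ≋ const uᴾ Defs.+ z Defs.* F [u≔ 1ᴾ +ᴾ uᴾ *ᴾ vᴾ ] Defs.* F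
  merged-series m n = ≃⇒≈ᴾ (begin
    F n ≈⟨ F≃ n ⟩
    pathSum uᴾ n 1 L⁰ ≈⟨ merged-equation m n ⟩
    monomial n +ᴾ shift (conv (λ k → pathSum y k 1 L⁰) g) n
      ≈⟨ Poly.+-cong (Poly.reflexive (monomial≡const n))
           (shift-cong (λ n → conv-cong n (λ k → Poly.sym (F[u≔]≃ y k)) (λ k → Poly.sym (F≃ k))) n) ⟩
    const uᴾ n +ᴾ shift (conv (F [u≔ y ]) F) n
      ≈⟨ Poly.+-congˡ {const uᴾ n} (z*-* (F [u≔ y ]) F n) ⟨
    const uᴾ n +ᴾ (z Defs.* F [u≔ y ] Defs.* F) n ∎)

  fresh-series : Fresh φ 1 L⁰ L⁰ →
    F ≋ const uᴾ Defs.+ z Defs.* (F [u≔ 1ᴾ +ᴾ uᴾ *ᴾ vᴾ ] Defs.- F [u≔ 1ᴾ ]) Defs.* F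
  fresh-series f n = ≃⇒≈ᴾ (begin
    F n ≈⟨ cancel n ⟩
    const uᴾ n +ᴾ shift (conv (F [u≔ y ] Defs.- F [u≔ 1ᴾ ]) F) n
      ≈⟨ Poly.+-congˡ {const uᴾ n} (z*-* (F [u≔ y ] Defs.- F [u≔ 1ᴾ ]) F n) ⟨
    const uᴾ n +ᴾ (z Defs.* (F [u≔ y ] Defs.- F [u≔ 1ᴾ ]) Defs.* F) n ∎)
    where
    -- Integer coefficients enter here: convolution with the negated series is added to both sides
    -- of `fresh-equation`.
    cancel : ∀ n → F n ≃ const uᴾ n +ᴾ shift (conv (F [u≔ y ] Defs.- F [u≔ 1ᴾ ]) F) n
    cancel zero = begin
      F 0 ≈⟨ F≃ 0 ⟩
      pathSum uᴾ 0 1 L⁰ ≈⟨ Poly.+-identityʳ _ ⟨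
      pathSum uᴾ 0 1 L⁰ +ᴾ 0ᴾ ≈⟨ fresh-equation f 0 ⟩
      uᴾ +ᴾ 0ᴾ ∎
    cancel (suc n) = begin
      F (suc n)
        ≈⟨ F≃ (suc n) ⟩
      pathSum uᴾ (suc n) 1 L⁰
        ≈⟨ Poly.+-identityʳ _ ⟨
      pathSum uᴾ (suc n) 1 L⁰ +ᴾ 0ᴾ
        ≈⟨ Poly.+-congˡ {pathSum uᴾ (suc n) 1 L⁰} conv-inverse ⟨
      pathSum uᴾ (suc n) 1 L⁰ +ᴾ (conv (λ k → pathSum 1ᴾ k 1 L⁰) g n +ᴾ conv negated F n)
        ≈⟨ Poly.+-assoc (pathSum uᴾ (suc n) 1 L⁰) _ _ ⟨
      pathSum uᴾ (suc n) 1 L⁰ +ᴾ conv (λ k → pathSum 1ᴾ k 1 L⁰) g n +ᴾ conv negated F n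
        ≈⟨ Poly.+-congʳ {conv negated F n} (fresh-equation f (suc n)) ⟩
      conv (λ k → pathSum y k 1 L⁰) g n +ᴾ conv negated F n
        ≈⟨ Poly.+-congʳ {conv negated F n} (conv-cong n (λ k → Poly.sym (F[u≔]≃ y k)) (λ k → Poly.sym (F≃ k))) ⟩
      conv (F [u≔ y ]) F n +ᴾ conv negated F n
        ≈⟨ conv-+ (F [u≔ y ]) negated F n ⟨
      conv (F [u≔ y ] Defs.- F [u≔ 1ᴾ ]) F n ∎
      where
      negated : Series
      negated k = -ᴾ (F [u≔ 1ᴾ ]) k
      conv-inverse : conv (λ k → pathSum 1ᴾ k 1 L⁰) g n +ᴾ conv negated F n ≃ 0ᴾ
      conv-inverse = begin
        conv (λ k → pathSum 1ᴾ k 1 L⁰) g n +ᴾ conv negated F n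
          ≈⟨ Poly.+-congʳ {conv negated F n} (conv-cong n (λ k → Poly.sym (F[u≔]≃ 1ᴾ k)) (λ k → Poly.sym (F≃ k))) ⟩
        conv (F [u≔ 1ᴾ ]) F n +ᴾ conv negated F n
          ≈⟨ conv-+ (F [u≔ 1ᴾ ]) negated F n ⟨
        conv (λ k → (F [u≔ 1ᴾ ]) k +ᴾ negated k) F n
          ≈⟨ conv-congˡ F n (λ k → +ᴾ-inverseʳ ((F [u≔ 1ᴾ ]) k)) ⟩
        conv (λ _ → 0ᴾ) F n
          ≈⟨ conv-0 F n ⟩
        0ᴾ ∎

open Defs using (_+_; _-_; _*_)

theorem6p4 : (B ≋ const uᴾ + z * B [u≔ 1ᴾ +ᴾ uᴾ *ᴾ vᴾ ] * B)
    × (C ≋ const uᴾ + z * (C [u≔ 1ᴾ +ᴾ uᴾ *ᴾ vᴾ ] - C [u≔ 1ᴾ ]) * C)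
theorem6p4 =
  -- Only intervals starting at 0 are forbidden, so the state is merged from the outset.
  GeneratingFunction.merged-series indecomposable? (_≡ᵇ 0) false ≡.refl (λ _ → ≡.refl) indecomposable⇔ (record
    { lift   = record { bottom = ≡.refl ; above = λ _ → ≡.refl ; beyond = λ { (suc p) _ → ≡.refl , ≡.refl } }
    ; second = λ _ → ≡.refl
    }) ,
  -- Every start is forbidden at first, so the second chord is not yet linked to the bottom one.
  GeneratingFunction.fresh-series connected? (λ _ → true) true ≡.refl (λ _ → ≡.refl) connected⇔ (record
    { lift   = record { bottom = ≡.refl ; above = λ _ → ≡.refl ; beyond = λ _ _ → ≡.refl , ≡.refl }
    ; second = ≡.refl
    ; first  = ≡.refl
    })
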